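{- Let $d, n$ be positive integers, let $t\in\mathbb{R}^d$, and let $X_1,\ldots,X_{n-1}\subseteq\mathbb{R}^d$ be 1-dense sets. Then there exist a tuple $(p_0,\ldots,p_n)$ of points of $\mathbb{R}^d$ and a vector $s\in\mathbb{R}^d$ such that $p_0=\underline{0}$, $p_n=t$, $p_i\in X_i$ for all $1\le i\le n-1$, and $\|(p_{i+1}-p_i)-s\|\le\sqrt{2}$ for all $0\le i\le n-1$. In particular, $D_d\le D'_d\le 2\sqrt{2}$ for every positive integer $d$.
   Context: $\|\cdot\|$ is the Euclidean norm on $\mathbb{R}^d$, $\underline{0}$ is the origin, and $\operatorname{dist}$ is Euclidean distance. A set $X\subseteq\mathbb{R}^d$ is called 1-dense if $\operatorname{dist}(y,X)<1$ for every $y\in\mathbb{R}^d$ (equivalently, $X$ intersects every open unit ball). For a tuple $(p_0,\ldots,p_n)$ of points of $\mathbb{R}^d$ with $n\ge 1$, define $$\delta(p_0,\ldots,p_n)=\max_{0\le i<j<n}\big\|(p_{i+1}-p_i)-(p_{j+1}-p_j)\big\|$$ (understood as $0$ when $n=1$) and $$\delta'(p_0,\ldots,p_n)=2\cdot\min_{s\in\mathbb{R}^d}\ \max_{0\le i<n}\big\|(p_{i+1}-p_i)-s\big\|.$$ Define $$D_d=\sup\ \inf\ \delta(p_0,\ldots,p_n),$$ where the supremum is over all positive integers $n$, all $t\in\mathbb{R}^d$ and all 1-dense sets $X_1,\ldots,X_{n-1}\subseteq\mathbb{R}^d$, and the infimum is over all tuples with $p_0=\underline{0}$, $p_n=t$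 and $p_i\in X_i$ for $1\le i\le n-1$. The quantity $D'_d$ is defined in the same way with $\delta'$ in place of $\delta$. -}

module Defs where

open import Level using (0ℓ)
open import Algebra.Bundles using (CommutativeRing)
import Algebra.Definitions.RawMonoid as RawMonoidDefs
import Algebra.Properties.Ring as RingProperties
open import Data.Fin.Base using (Fin; zero; suc; fromℕ; inject; inject₁; toℕ)
open import Data.Nat.Base using (ℕ; suc)
open import Data.Product.Base using (Σ; ∃; _×_; _,_; proj₁; proj₂)
open import Data.Sum.Base using (_⊎_; inj₁; inj₂; [_,_]′)
open import Data.Vec.Functional using (Vector; foldr)
open import Data.Vec.Functional.Relation.Binary.Pointwise using (Pointwise)
open import Relation.Binary.Core using (Rel)
open import Relation.Binary.Definitions using (_Respects_)
open import Relation.Binary.Structures using (IsTotalOrder)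
import Relation.Binary.Construct.NonStrictToStrict as ToStrict
open import Relation.Nullary.Negation using (¬_)
open import Relation.Unary using (Pred; _∈_; Satisfiable)

module Bounds {A : Set} (_≤_ : Rel A 0ℓ) where

  UpperBound LowerBound : ∀ {ℓ} → Pred A ℓ → A → Set ℓ
  UpperBound S b = ∀ x → x ∈ S → x ≤ b
  LowerBound S b = ∀ x → x ∈ S → b ≤ x

  IsSup IsInf IsMin : ∀ {ℓ} → Pred A ℓ → A → Set ℓ
  IsSup S s = UpperBound S s × (∀ b → UpperBound S b → s ≤ b)
  IsInf S s = LowerBound S s × (∀ b → LowerBound S b → b ≤ s)
  IsMin S s = s ∈ S × LowerBound S s

-- The real numbers, axiomatised up to unique isomorphism.  Equality is the
-- setoid equality of the underlying ring, since quotients are not available.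
record CompleteOrderedField : Set₁ where
  field
    commutativeRing : CommutativeRing 0ℓ 0ℓ

  open CommutativeRing commutativeRing public

  infix 4 _≤_
  field
    _≤_          : Rel Carrier 0ℓ
    isTotalOrder : IsTotalOrder _≈_ _≤_
    +-monoˡ-≤    : ∀ z {x y} → x ≤ y → x + z ≤ y + z
    *-nonneg     : ∀ {x y} → 0# ≤ x → 0# ≤ y → 0# ≤ x * y
    0≉1          : ¬ (0# ≈ 1#)
    inverse      : ∀ x → ¬ (x ≈ 0#) → ∃ λ y → x * y ≈ 1#

  open Bounds _≤_ public

  field
    complete : (S : Pred Carrier 0ℓ) → Satisfiable S → ∃ (UpperBound S) → ∃ (IsSup S)

  open IsTotalOrder isTotalOrder public
    using (total; ≤-respˡ-≈; ≤-respʳ-≈)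
    renaming (refl to ≤-refl; reflexive to ≤-reflexive; trans to ≤-trans; antisym to ≤-antisym)

  open ToStrict _≈_ _≤_ public using (_<_)

module Euclidean (ℝ : CompleteOrderedField) where

  open CompleteOrderedField ℝ hiding (zero)
  open RawMonoidDefs +-rawMonoid using (sum)
  open RingProperties ring using (-‿distribˡ-*; -‿involutive)

  private
    neg-nonneg : ∀ {x} → x ≤ 0# → 0# ≤ - x
    neg-nonneg {x} x≤0 =
      ≤-respˡ-≈ (-‿inverseʳ x) (≤-respʳ-≈ (+-identityˡ (- x)) (+-monoˡ-≤ (- x) x≤0))

    0≤1 : 0# ≤ 1#
    0≤1 = [ (λ p → p) , (λ 1≤0 → ≤-respʳ-≈ -1*-1≈1 (*-nonneg (neg-nonneg 1≤0) (neg-nonneg 1≤0))) ]′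
            (total 0# 1#)
      where
      -1*-1≈1 : - 1# * - 1# ≈ 1#
      -1*-1≈1 = trans (sym (-‿distribˡ-* 1# (- 1#)))
                (trans (-‿cong (*-identityˡ (- 1#))) (-‿involutive 1#))

    y≤y*y : ∀ {y} → 1# ≤ y → y ≤ y * y
    y≤y*y {y} 1≤y =
      ≤-respˡ-≈ (+-identityˡ y) (≤-respʳ-≈ eq (+-monoˡ-≤ y (*-nonneg 0≤y-1 (≤-trans 0≤1 1≤y))))
      where
      0≤y-1 : 0# ≤ y + - 1#
      0≤y-1 = ≤-respˡ-≈ (-‿inverseʳ 1#) (+-monoˡ-≤ (- 1#) 1≤y)
      eq : (y + - 1#) * y + y ≈ y * y
      eq = trans (+-congʳ (trans (distribʳ y y (- 1#))
                            (+-congˡ (trans (sym (-‿distribˡ-* 1# y)) (-‿cong (*-identityˡ y))))))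
           (trans (+-assoc (y * y) (- y) y)
           (trans (+-congˡ (-‿inverseˡ y)) (+-identityʳ (y * y))))

  infixl 6 _⊔_
  _⊔_ : Carrier → Carrier → Carrier
  x ⊔ y = [ (λ _ → y) , (λ _ → x) ]′ (total x y)

  private
    x≤x⊔y : ∀ x y → x ≤ x ⊔ y
    x≤x⊔y x y with total x y
    ... | inj₁ x≤y = x≤y
    ... | inj₂ y≤x = ≤-refl

    y≤x⊔y : ∀ x y → y ≤ x ⊔ y
    y≤x⊔y x y with total x y
    ... | inj₁ x≤y = ≤-refl
    ... | inj₂ y≤x = y≤x

  -- Maximum of a finite family of nonnegative numbers; 0 for the empty family.
  max : ∀ {n} → Vector Carrier n → Carrier
  max = foldr _⊔_ 0#

  -- √ x = sup { y : y ≤ 0 or y² ≤ x }.  The disjunct y ≤ 0 only serves to make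
  -- √ total, with value 0 at negative x.
  √-set : Carrier → Pred Carrier 0ℓ
  √-set x y = y ≤ 0# ⊎ y * y ≤ x

  private
    √-bounded : ∀ x → UpperBound (√-set x) (1# ⊔ x)
    √-bounded x y (inj₁ y≤0) = ≤-trans y≤0 (≤-trans 0≤1 (x≤x⊔y 1# x))
    √-bounded x y (inj₂ y²≤x) with total y 1#
    ... | inj₁ y≤1 = ≤-trans y≤1 (x≤x⊔y 1# x)
    ... | inj₂ 1≤y = ≤-trans (y≤y*y 1≤y) (≤-trans y²≤x (y≤x⊔y 1# x))

    √-sup : ∀ x → ∃ (IsSup (√-set x))
    √-sup x = complete (√-set x) (0# , inj₁ ≤-refl) (1# ⊔ x , √-bounded x)

  infix 9 √_
  √_ : Carrier → Carrier
  √ x = proj₁ (√-sup x)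

  √-isSup : ∀ x → IsSup (√-set x) (√ x)
  √-isSup x = proj₂ (√-sup x)

  2# : Carrier
  2# = 1# + 1#

  Point : ℕ → Set
  Point d = Vector Carrier d

  infix 4 _≋_
  _≋_ : ∀ {d} → Rel (Point d) 0ℓ
  _≋_ = Pointwise _≈_

  origin : ∀ {d} → Point d
  origin _ = 0#

  infixl 6 _⊖_
  _⊖_ : ∀ {d} → Point d → Point d → Point d
  (x ⊖ y) k = x k - y k

  ‖_‖ : ∀ {d} → Point d → Carrier
  ‖ x ‖ = √ (sum (λ k → x k * x k))

  record Subset (d : ℕ) : Set₁ where
    field
      pred     : Pred (Point d) 0ℓ
      respects : pred Respects _≋_

  infix 4 _∈ˢ_
  _∈ˢ_ : ∀ {d} → Point d → Subset d → Set
  x ∈ˢ X = x ∈ Subset.pred X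

  -- "r = dist(y, X)".  No r satisfies this when X is empty, where the distance
  -- is +∞.
  IsDist : ∀ {d} → Point d → Subset d → Carrier → Set
  IsDist y X = IsInf (λ r → ∃ λ x → x ∈ˢ X × r ≈ ‖ y ⊖ x ‖)

  OneDense : ∀ {d} → Subset d → Set
  OneDense {d} X = (y : Point d) → ∃ λ r → IsDist y X r × r < 1#

  Tuple : ℕ → ℕ → Set
  Tuple d n = Vector (Point d) (suc n)

  step : ∀ {d n} → Tuple d n → Fin n → Point d
  step p i = p (suc i) ⊖ p (inject₁ i)

  -- The inner index i ranges over Fin (toℕ j), i.e. over i < j.
  δ : ∀ {d n} → Tuple d n → Carrier
  δ {n = n} p = max {n} λ j → max {toℕ j} λ i → ‖ step p (inject i) ⊖ step p j ‖

  -- "v = δ′(p)"; relational because the minimum over s is over an infinite set.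
  Isδ′ : ∀ {d n} → Tuple d n → Carrier → Set
  Isδ′ {d} p v = ∃ λ m →
    IsMin (λ r → Σ (Point d) λ s → r ≈ max (λ i → ‖ step p i ⊖ s ‖)) m × v ≈ 2# * m

  -- Here n = suc m, and the sets X₁, …, X_{n-1} are indexed from 0: X i is
  -- the set usually written X_{i+1}, constraining p_{i+1}.
  record Admissible {d m : ℕ} (t : Point d) (X : Fin m → Subset d) (p : Tuple d (suc m)) : Set where
    field
      start  : p zero ≋ origin
      end    : p (fromℕ (suc m)) ≋ t
      member : ∀ i → p (suc (inject₁ i)) ∈ˢ X i

  -- "v = sup inf Δ(p)" for a functional Δ given by its graph; every infimum
  -- involved is over a nonempty set of nonnegative reals, hence a real number.
  IsSupInf : (d : ℕ) → (∀ {n} → Tuple d n → Carrier → Set) → Carrier → Set₁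
  IsSupInf d IsΔ = IsSup λ v →
    Σ ℕ λ m → Σ (Point d) λ t → Σ (Fin m → Subset d) λ X →
      (∀ i → OneDense (X i)) ×
      IsInf (λ r → Σ (Tuple d (suc m)) λ p → Admissible t X p × IsΔ p r) v

  IsD IsD′ : (d : ℕ) → Carrier → Set₁
  IsD  d = IsSupInf d λ p v → v ≈ δ p
  IsD′ d = IsSupInf d Isδ′

{-# OPTIONS --safe #-}
-- Fix s and run a virtual walk backwards from y = t: given y, let c = y − s and
-- replace y by an average of points of X ∩ B(c, 1), with weights depending
-- continuously on c.  The final y is a continuous function of s, and s − y has
-- opposite signs on opposite facets of a large cube, so by the
-- Poincaré–Miranda theorem some s has y = s, i.e. the virtual walk ends at 0.
-- A real walk is then chosen forwards.  If |z − y| ≤ 1 and y is an average of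
-- points x with |c − x| < 1, some such x satisfies
-- |z − x|² ≤ |z − y|² + |c − x|² ≤ 2, because |z − x|² − |c − x|² is affine in x;
-- and |c − x| < 1 is the hypothesis needed for the next step from x.
--
-- The Poincaré–Miranda theorem is reduced, by compactness, to 0/1-valued
-- functions a₀, …, a_{d−1} on the grid [0, N]^d.  With ∂a the coboundary mod 2,
-- Stokes' theorem gives ∫ ∂a₀ ⌣ ⋯ ⌣ ∂a_{d−1} = 1, so there is a unit cube on
-- which no a_k is constant.
module Submission where

open import Defs
open import Level using (0ℓ; Lift; lift; lower) renaming (suc to lsuc)
open import Axiom.ExcludedMiddle using (ExcludedMiddle)
open import Algebra.Bundles using (CommutativeRing)
import Algebra.Definitions.RawMonoid as RawMonoidDefs
import Algebra.Properties.AbelianGroup as AbelianGroupProperties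
import Algebra.Properties.Ring as RingProperties
import Algebra.Properties.Semiring.Mult.TCOptimised as Mult
import Algebra.Properties.Semiring.Sum as Sum
import Algebra.Solver.Ring as RingSolver
open import Algebra.Solver.Ring.AlmostCommutativeRing using (fromCommutativeRing; _-Raw-AlmostCommutative⟶_)
open import Data.Bool.Base using (Bool; true; false; _∧_; _xor_)
open import Data.Bool.Properties using (∧-zeroʳ; xor-same)
open import Data.Bool.Solver using (module xor-∧-Solver)
open import Data.Empty using (⊥-elim)
open import Data.Fin.Base using (Fin; zero; suc; fromℕ; inject; inject₁; toℕ)
open import Data.Integer.Base as ℤ using (ℤ; +_; -[1+_])
import Data.Integer.Properties as ℤₚ
open import Data.List.Base using (List; []; _∷_; _++_)
open import Data.List.Relation.Unary.All as All using (All; []; _∷_)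
import Data.List.Relation.Unary.All.Properties as All
open import Data.List.Relation.Unary.Any as Any using (Any; here; there)
import Data.List.Relation.Unary.Any.Properties as Any
open import Data.Maybe.Base using (Maybe; just; nothing)
open import Data.Nat.Base as ℕ using (ℕ; zero; suc; NonZero)
import Data.Nat.Properties as ℕₚ
open import Data.Product.Base using (Σ; ∃; _×_; _,_; proj₁; proj₂)
open import Data.Sum.Base using (_⊎_; inj₁; inj₂; [_,_]′)
open import Data.Unit.Base using (⊤)
open import Data.Vec.Base using (Vec; []; _∷_; lookup)
open import Data.Vec.Functional using (Vector; head; tail) renaming (_∷_ to _◂_)
open import Function.Base using (_∘_; case_of_)
open import Relation.Binary.PropositionalEquality as ≡ using (_≡_)
import Relation.Binary.Reasoning.Setoid as SetoidReasoning
open import Relation.Nullary.Decidable using (Dec; yes; no; True; toWitness; fromWitness; does; dec-true; dec-false)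
open import Relation.Nullary.Negation using (¬_)
open import Relation.Unary using (Pred; _∈_; _⊆_; _∪_; Satisfiable)

-- Picking a nearest point of X is discontinuous in c, so no topological argument applies to a walk
-- inside the sets themselves. Averaging with weights (1 - |c - x|²)⁺ restores continuity, and
-- compactness lets finitely many x suffice, so each average is a finite sum. Averages need not lie
-- in X, which is why a second walk is required; √2 in place of 1 is the price of returning from an
-- average to a point. The cube is |s_k| ≤ T + 1, where T bounds the coordinates of t: with that
-- size the shift by -s outweighs the averaging on every facet. If s - y had no zero, every point of
-- the cube would have a neighbourhood on which some coordinate keeps a strict sign. Compactness
-- gives one scale ε for all points, and on a grid of mesh ε every unit cube would have a constant
-- a_k. Working modulo 2 removes all orientation signs. The constant D′ raises a separate question:
-- the minimum over s in δ′ has to be attained. This is compactness again, together with growth of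
-- the maximum outside a large box.

module Cochains where

  -- Cubical cochains modulo 2

  open ≡ using (_≗_; refl; sym; trans; cong; cong₂)

  -- A cell of the cubical subdivision of ℝ is a pair (b , x): the point x if b
  -- is false, the interval [x , x + 1] if b is true.
  Cell : Set
  Cell = Bool × ℕ

  Face : ℕ → Set
  Face d = Vec Cell d

  -- All degrees at once: a value on faces of every dimension, so that no degree index is carried
  -- through `_⌣_` and `∂`.
  Cochain : ℕ → Set
  Cochain d = Face d → Bool

  private variable
    d n : ℕ

  infixl 8 _at_
  _at_ : Cochain (suc d) → Cell → Cochain d
  (α at c) F = α (c ∷ F)

  infixr 7 _⌣_
  -- Serre's cubical cup product. In each interval direction exactly one factor carries the
  -- interval; the other is evaluated at its start if it is `α`, at its end if it is `β`.
  _⌣_ : Cochain d → Cochain d → Cochain d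
  (α ⌣ β) [] = α [] ∧ β []
  (α ⌣ β) ((false , x) ∷ F) = ((α at (false , x)) ⌣ (β at (false , x))) F
  (α ⌣ β) ((true , x) ∷ F) =
    ((α at (false , x)) ⌣ (β at (true , x))) F xor
    ((α at (true , x)) ⌣ (β at (false , suc x))) F

  -- The coboundary, not the boundary.
  ∂ : Cochain d → Cochain d
  ∂ α [] = false
  ∂ α ((false , x) ∷ F) = ∂ (α at (false , x)) F
  ∂ α ((true , x) ∷ F) =
    ∂ (α at (true , x)) F xor (α ((false , suc x) ∷ F) xor α ((false , x) ∷ F))

  infixl 6 _⊕_
  _⊕_ : Cochain d → Cochain d → Cochain d
  (α ⊕ β) F = α F xor β F

  ⌣-cong : {α α′ β β′ : Cochain d} → α ≗ α′ → β ≗ β′ → α ⌣ β ≗ α′ ⌣ β′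
  ⌣-cong p q [] = cong₂ _∧_ (p []) (q [])
  ⌣-cong p q ((false , x) ∷ F) = ⌣-cong (p ∘ (_ ∷_)) (q ∘ (_ ∷_)) F
  ⌣-cong p q ((true , x) ∷ F) =
    cong₂ _xor_ (⌣-cong (p ∘ (_ ∷_)) (q ∘ (_ ∷_)) F) (⌣-cong (p ∘ (_ ∷_)) (q ∘ (_ ∷_)) F)

  open xor-∧-Solver using (solve; con; _:=_; _:+_; _:*_)

  xor-interchange : ∀ a b c e → (a xor b) xor (c xor e) ≡ (a xor c) xor (b xor e)
  xor-interchange = solve 4 (λ a b c e → (a :+ b) :+ (c :+ e) := (a :+ c) :+ (b :+ e)) refl

  ∂-⊕ : (α β : Cochain d) → ∂ (α ⊕ β) ≗ ∂ α ⊕ ∂ β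
  ∂-⊕ α β [] = refl
  ∂-⊕ α β ((false , x) ∷ F) = ∂-⊕ (α at (false , x)) (β at (false , x)) F
  ∂-⊕ α β ((true , x) ∷ F) = trans
    (cong₂ _xor_ (∂-⊕ (α at (true , x)) (β at (true , x)) F) (xor-interchange a b a′ b′))
    (xor-interchange (∂ (α at (true , x)) F) (∂ (β at (true , x)) F) (a xor a′) (b xor b′))
    where
    a b a′ b′ : Bool
    a = α ((false , suc x) ∷ F)
    b = β ((false , suc x) ∷ F)
    a′ = α ((false , x) ∷ F)
    b′ = β ((false , x) ∷ F)

  ⌣-⊕ʳ : (α β γ : Cochain d) → α ⌣ (β ⊕ γ) ≗ (α ⌣ β) ⊕ (α ⌣ γ)
  ⌣-⊕ʳ α β γ [] = solve 3 (λ a b c → a :* (b :+ c) := a :* b :+ a :* c) refl (α []) (β []) (γ [])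
  ⌣-⊕ʳ α β γ ((false , x) ∷ F) =
    ⌣-⊕ʳ (α at (false , x)) (β at (false , x)) (γ at (false , x)) F
  ⌣-⊕ʳ α β γ ((true , x) ∷ F) = trans
    (cong₂ _xor_ (⌣-⊕ʳ (α at (false , x)) (β at (true , x)) (γ at (true , x)) F)
                 (⌣-⊕ʳ (α at (true , x)) (β at (false , suc x)) (γ at (false , suc x)) F))
    (xor-interchange
      ((α at (false , x) ⌣ β at (true , x)) F) ((α at (false , x) ⌣ γ at (true , x)) F)
      ((α at (true , x) ⌣ β at (false , suc x)) F) ((α at (true , x) ⌣ γ at (false , suc x)) F))

  ⌣-⊕ˡ : (α β γ : Cochain d) → (α ⊕ β) ⌣ γ ≗ (α ⌣ γ) ⊕ (β ⌣ γ)
  ⌣-⊕ˡ α β γ [] = solve 3 (λ a b c → (a :+ b) :* c := a :* c :+ b :* c) refl (α []) (β []) (γ [])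
  ⌣-⊕ˡ α β γ ((false , x) ∷ F) =
    ⌣-⊕ˡ (α at (false , x)) (β at (false , x)) (γ at (false , x)) F
  ⌣-⊕ˡ α β γ ((true , x) ∷ F) = trans
    (cong₂ _xor_ (⌣-⊕ˡ (α at (false , x)) (β at (false , x)) (γ at (true , x)) F)
                 (⌣-⊕ˡ (α at (true , x)) (β at (true , x)) (γ at (false , suc x)) F))
    (xor-interchange
      ((α at (false , x) ⌣ γ at (true , x)) F) ((β at (false , x) ⌣ γ at (true , x)) F)
      ((α at (true , x) ⌣ γ at (false , suc x)) F) ((β at (true , x) ⌣ γ at (false , suc x)) F))

  leibniz : (α β : Cochain d) → ∂ (α ⌣ β) ≗ (∂ α ⌣ β) ⊕ (α ⌣ ∂ β)
  leibniz α β [] = sym (∧-zeroʳ (α []))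
  leibniz α β ((false , x) ∷ F) = leibniz (α at (false , x)) (β at (false , x)) F
  leibniz {suc d} α β ((true , x) ∷ F) = trans lhs (trans
    -- `w` is the mixed term `α₀ ⌣ β₀⁺`: it splits the difference `u :+ v` of the two end products
    -- into differences in one factor at a time, and cancels modulo 2.
    (solve 7 (λ p q r s u v w →
         ((p :+ q) :+ (r :+ s)) :+ (u :+ v) := (p :+ (r :+ (u :+ w))) :+ ((q :+ (w :+ v)) :+ s))
      refl ((∂ α₀ ⌣ β₁) F) ((α₀ ⌣ ∂ β₁) F) ((∂ α₁ ⌣ β₀⁺) F) ((α₁ ⌣ ∂ β₀⁺) F)
        ((α₀⁺ ⌣ β₀⁺) F) ((α₀ ⌣ β₀) F) ((α₀ ⌣ β₀⁺) F))
    (cong₂ _xor_ (cong ((∂ α₀ ⌣ β₁) F xor_) (sym rhsˡ)) (cong (_xor (α₁ ⌣ ∂ β₀⁺) F) (sym rhsʳ))))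
    where
    α₀ α₁ α₀⁺ β₀ β₁ β₀⁺ : Cochain d
    α₀ = α at (false , x)
    α₁ = α at (true , x)
    α₀⁺ = α at (false , suc x)
    β₀ = β at (false , x)
    β₁ = β at (true , x)
    β₀⁺ = β at (false , suc x)

    lhs : ∂ (α ⌣ β) ((true , x) ∷ F) ≡
      (((∂ α₀ ⌣ β₁) F xor (α₀ ⌣ ∂ β₁) F) xor ((∂ α₁ ⌣ β₀⁺) F xor (α₁ ⌣ ∂ β₀⁺) F)) xor
      ((α₀⁺ ⌣ β₀⁺) F xor (α₀ ⌣ β₀) F)
    lhs = cong (_xor ((α₀⁺ ⌣ β₀⁺) F xor (α₀ ⌣ β₀) F))
      (trans (∂-⊕ (α₀ ⌣ β₁) (α₁ ⌣ β₀⁺) F) (cong₂ _xor_ (leibniz α₀ β₁ F) (leibniz α₁ β₀⁺ F)))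

    rhsˡ : ((∂ α₁ ⊕ (α₀⁺ ⊕ α₀)) ⌣ β₀⁺) F ≡
      (∂ α₁ ⌣ β₀⁺) F xor ((α₀⁺ ⌣ β₀⁺) F xor (α₀ ⌣ β₀⁺) F)
    rhsˡ = trans (⌣-⊕ˡ (∂ α₁) (α₀⁺ ⊕ α₀) β₀⁺ F)
      (cong ((∂ α₁ ⌣ β₀⁺) F xor_) (⌣-⊕ˡ α₀⁺ α₀ β₀⁺ F))

    rhsʳ : (α₀ ⌣ (∂ β₁ ⊕ (β₀⁺ ⊕ β₀))) F ≡
      (α₀ ⌣ ∂ β₁) F xor ((α₀ ⌣ β₀⁺) F xor (α₀ ⌣ β₀) F)
    rhsʳ = trans (⌣-⊕ʳ α₀ (∂ β₁) (β₀⁺ ⊕ β₀) F)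
      (cong ((α₀ ⌣ ∂ β₁) F xor_) (⌣-⊕ʳ α₀ β₀⁺ β₀ F))

  ∂∂ : (α : Cochain d) (F : Face d) → ∂ (∂ α) F ≡ false
  ∂∂ α [] = refl
  ∂∂ α ((false , x) ∷ F) = ∂∂ (α at (false , x)) F
  ∂∂ {suc d} α ((true , x) ∷ F) =
    trans (cong (_xor (∂ α₀⁺ F xor ∂ α₀ F))
            (trans (∂-⊕ (∂ (α at (true , x))) (α₀⁺ ⊕ α₀) F)
              (cong₂ _xor_ (∂∂ (α at (true , x)) F) (∂-⊕ α₀⁺ α₀ F))))
          (xor-same (∂ α₀⁺ F xor ∂ α₀ F))
    where
    α₀ α₀⁺ : Cochain d
    α₀ = α at (false , x)
    α₀⁺ = α at (false , suc x)

  -- Product subcomplexes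

  record Subcomplex₁ : Set₁ where
    field
      has    : Cell → Set
      closed : ∀ {x} → has (true , x) → has (false , x) × has (false , suc x)

  open Subcomplex₁

  Subcomplex : ℕ → Set₁
  Subcomplex d = Fin d → Subcomplex₁

  _∈ᶠ_ : Face d → Subcomplex d → Set
  F ∈ᶠ K = ∀ i → has (K i) (lookup F i)

  _∈ᵛ_ : Vec ℕ d → Subcomplex d → Set
  v ∈ᵛ K = ∀ i → has (K i) (false , lookup v i)

  VanishesOn : Subcomplex d → Cochain d → Set
  VanishesOn K α = ∀ F → F ∈ᶠ K → α F ≡ false

  private
    consᶠ : {K : Subcomplex (suc d)} {c : Cell} {F : Face d} →
            has (K zero) c → F ∈ᶠ (K ∘ suc) → (c ∷ F) ∈ᶠ K
    consᶠ p q zero = p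
    consᶠ p q (suc i) = q i

    consᵛ : {K : Subcomplex (suc d)} {x : ℕ} {v : Vec ℕ d} →
            has (K zero) (false , x) → v ∈ᵛ (K ∘ suc) → (x ∷ v) ∈ᵛ K
    consᵛ p q zero = p
    consᵛ p q (suc i) = q i

  -- The product evaluates `α` only on faces of the given cell: where `β` carries an interval, `α`
  -- sits at its initial endpoint, which `closed` keeps in `K`. The mirror image for `β` uses the
  -- terminal endpoint.
  ⌣-vanishesˡ : (K : Subcomplex d) (α β : Cochain d) → VanishesOn K α → VanishesOn K (α ⌣ β)
  ⌣-vanishesˡ K α β p [] F∈K = cong (_∧ β []) (p [] F∈K)
  ⌣-vanishesˡ K α β p ((false , x) ∷ F) F∈K =
    ⌣-vanishesˡ (K ∘ suc) _ _ (λ G G∈K → p _ (consᶠ {K = K} (F∈K zero) G∈K)) F (F∈K ∘ suc)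
  ⌣-vanishesˡ K α β p ((true , x) ∷ F) F∈K = cong₂ _xor_
    (⌣-vanishesˡ (K ∘ suc) _ _
      (λ G G∈K → p _ (consᶠ {K = K} (proj₁ (closed (K zero) (F∈K zero))) G∈K)) F (F∈K ∘ suc))
    (⌣-vanishesˡ (K ∘ suc) _ _ (λ G G∈K → p _ (consᶠ {K = K} (F∈K zero) G∈K)) F (F∈K ∘ suc))

  ⌣-vanishesʳ : (K : Subcomplex d) (α β : Cochain d) → VanishesOn K β → VanishesOn K (α ⌣ β)
  ⌣-vanishesʳ K α β p [] F∈K = trans (cong (α [] ∧_) (p [] F∈K)) (∧-zeroʳ (α []))
  ⌣-vanishesʳ K α β p ((false , x) ∷ F) F∈K =
    ⌣-vanishesʳ (K ∘ suc) _ _ (λ G G∈K → p _ (consᶠ {K = K} (F∈K zero) G∈K)) F (F∈K ∘ suc)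
  ⌣-vanishesʳ K α β p ((true , x) ∷ F) F∈K = cong₂ _xor_
    (⌣-vanishesʳ (K ∘ suc) _ _ (λ G G∈K → p _ (consᶠ {K = K} (F∈K zero) G∈K)) F (F∈K ∘ suc))
    (⌣-vanishesʳ (K ∘ suc) _ _
      (λ G G∈K → p _ (consᶠ {K = K} (proj₂ (closed (K zero) (F∈K zero))) G∈K)) F (F∈K ∘ suc))

  -- Functions on the vertices as cochains of degree 0

  ⟪_⟫ : (Vec ℕ d → Bool) → Cochain d
  ⟪ a ⟫ [] = a []
  ⟪ a ⟫ ((false , x) ∷ F) = ⟪ a ∘ (x ∷_) ⟫ F
  ⟪ a ⟫ ((true , x) ∷ F) = false

  ConstantOn : Subcomplex d → (Vec ℕ d → Bool) → Bool → Set
  ConstantOn K a b = ∀ v → v ∈ᵛ K → a v ≡ b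

  ⟪⟫-agree : (K : Subcomplex d) (a a′ : Vec ℕ d → Bool) →
             (∀ v → v ∈ᵛ K → a v ≡ a′ v) → ∀ F → F ∈ᶠ K → ⟪ a ⟫ F ≡ ⟪ a′ ⟫ F
  ⟪⟫-agree K a a′ p [] F∈K = p [] (λ ())
  ⟪⟫-agree K a a′ p ((false , x) ∷ F) F∈K =
    ⟪⟫-agree (K ∘ suc) _ _ (λ v v∈K → p _ (consᵛ {K = K} (F∈K zero) v∈K)) F (F∈K ∘ suc)
  ⟪⟫-agree K a a′ p ((true , x) ∷ F) F∈K = refl

  ∂-zero : {α : Cochain d} → (∀ F → α F ≡ false) → ∀ F → ∂ α F ≡ false
  ∂-zero p [] = refl
  ∂-zero p ((false , x) ∷ F) = ∂-zero (p ∘ (_ ∷_)) F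
  ∂-zero p ((true , x) ∷ F) =
    cong₂ _xor_ (∂-zero (p ∘ (_ ∷_)) F) (cong₂ _xor_ (p (_ ∷ F)) (p (_ ∷ F)))

  ∂⟪⟫-vanishes : (K : Subcomplex d) (a : Vec ℕ d → Bool) (b : Bool) →
                 ConstantOn K a b → VanishesOn K (∂ ⟪ a ⟫)
  ∂⟪⟫-vanishes K a b p [] F∈K = refl
  ∂⟪⟫-vanishes K a b p ((false , x) ∷ F) F∈K =
    ∂⟪⟫-vanishes (K ∘ suc) _ b (λ v v∈K → p _ (consᵛ {K = K} (F∈K zero) v∈K)) F (F∈K ∘ suc)
  ∂⟪⟫-vanishes K a b p ((true , x) ∷ F) F∈K = cong₂ _xor_
    (∂-zero (λ _ → refl) F)
    (trans (cong (_xor ⟪ a ∘ (x ∷_) ⟫ F)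
             (⟪⟫-agree (K ∘ suc) _ _ (λ v v∈K → trans (p _ (consᵛ {K = K} (proj₂ ends) v∈K))
               (sym (p _ (consᵛ {K = K} (proj₁ ends) v∈K)))) F (F∈K ∘ suc)))
           (xor-same (⟪ a ∘ (x ∷_) ⟫ F)))
    where
    ends : has (K zero) (false , x) × has (K zero) (false , suc x)
    ends = closed (K zero) (F∈K zero)

  -- The number `n` of factors is independent of the dimension: the induction in `∫Π∂≡1` works with
  -- `d` factors in dimension `suc d`. The empty product is the unit of `_⌣_`.
  Π∂ : (Fin n → Vec ℕ d → Bool) → Cochain d
  Π∂ {zero} a = ⟪ (λ _ → true) ⟫
  Π∂ {suc n} a = ∂ ⟪ a zero ⟫ ⌣ Π∂ (a ∘ suc)

  ∂⟪const⟫ : (b : Bool) (F : Face d) → ∂ ⟪ (λ _ → b) ⟫ F ≡ false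
  ∂⟪const⟫ b [] = refl
  ∂⟪const⟫ b ((false , x) ∷ F) = ∂⟪const⟫ b F
  ∂⟪const⟫ b ((true , x) ∷ F) =
    cong₂ _xor_ (∂-zero (λ _ → refl) F) (xor-same (⟪ (λ _ → b) ⟫ F))

  private
    everything : Subcomplex d
    everything i = record { has = λ _ → ⊤ ; closed = λ _ → _ , _ }
  
  ⌣-zeroˡ : (α β : Cochain d) → (∀ F → α F ≡ false) → ∀ F → (α ⌣ β) F ≡ false
  ⌣-zeroˡ α β p F = ⌣-vanishesˡ everything α β (λ G _ → p G) F (λ _ → _)

  ⌣-zeroʳ : (α β : Cochain d) → (∀ F → β F ≡ false) → ∀ F → (α ⌣ β) F ≡ false
  ⌣-zeroʳ α β p F = ⌣-vanishesʳ everything α β (λ G _ → p G) F (λ _ → _)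

  ∂Π∂ : (a : Fin n → Vec ℕ d → Bool) (F : Face d) → ∂ (Π∂ a) F ≡ false
  ∂Π∂ {zero} a F = ∂⟪const⟫ true F
  ∂Π∂ {suc n} a F = trans (leibniz _ _ F)
    (cong₂ _xor_ (⌣-zeroˡ _ _ (∂∂ ⟪ a zero ⟫) F) (⌣-zeroʳ _ _ (∂Π∂ (a ∘ suc)) F))

  -- A constant function has zero coboundary, and one zero factor kills the product. Applied to
  -- facets this discards boundary terms; applied to unit cubes it gives the final contradiction.
  Π∂-vanishes : (K : Subcomplex d) (a : Fin n → Vec ℕ d → Bool) (k : Fin n) (b : Bool) →
                ConstantOn K (a k) b → VanishesOn K (Π∂ a)
  Π∂-vanishes K a zero b p = ⌣-vanishesˡ K _ _ (∂⟪⟫-vanishes K (a zero) b p)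
  Π∂-vanishes K a (suc k) b p = ⌣-vanishesʳ K _ _ (Π∂-vanishes K (a ∘ suc) k b p)

  Π∂-slice : (a : Fin n → Vec ℕ (suc d) → Bool) (x : ℕ) →
             Π∂ a at (false , x) ≗ Π∂ (λ k v → a k (x ∷ v))
  Π∂-slice {zero} a x F = refl
  Π∂-slice {suc n} a x F = ⌣-cong (λ _ → refl) (Π∂-slice (a ∘ suc) x) F

  -- Integration over the cube [0 , N]^d

  xorSum : ℕ → (ℕ → Bool) → Bool
  xorSum zero f = false
  xorSum (suc N) f = f N xor xorSum N f

  xorSum-cong : ∀ N {f g : ℕ → Bool} → f ≗ g → xorSum N f ≡ xorSum N g
  xorSum-cong zero p = refl
  xorSum-cong (suc N) p = cong₂ _xor_ (p N) (xorSum-cong N p)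

  xorSum-zero : ∀ N {f : ℕ → Bool} → (∀ x → f x ≡ false) → xorSum N f ≡ false
  xorSum-zero zero p = refl
  xorSum-zero (suc N) p = cong₂ _xor_ (p N) (xorSum-zero N p)

  xorSum-telescope : ∀ N (f g : ℕ → Bool) →
    xorSum N (λ x → f x xor (g (suc x) xor g x)) ≡ xorSum N f xor (g N xor g 0)
  xorSum-telescope zero f g = sym (xor-same (g 0))
  xorSum-telescope (suc N) f g = trans (cong ((f N xor (g (suc N) xor g N)) xor_) (xorSum-telescope N f g))
    (solve 5 (λ a b c e h → (a :+ (b :+ c)) :+ (e :+ (c :+ h)) := (a :+ e) :+ (b :+ h)) refl
      (f N) (g (suc N)) (g N) (xorSum N f) (g 0))

  xorSum-⊕ : ∀ N (f g : ℕ → Bool) → xorSum N (λ x → f x xor g x) ≡ xorSum N f xor xorSum N g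
  xorSum-⊕ zero f g = refl
  xorSum-⊕ (suc N) f g = trans (cong ((f N xor g N) xor_) (xorSum-⊕ N f g))
    (xor-interchange (f N) (g N) (xorSum N f) (xorSum N g))

  module Cube (N : ℕ) where

    ∫ : Cochain d → Bool
    ∫ {zero} α = α []
    ∫ {suc d} α = xorSum N λ x → ∫ (α at (true , x))

    ∫-cong : {α β : Cochain d} → α ≗ β → ∫ α ≡ ∫ β
    ∫-cong {zero} p = p []
    ∫-cong {suc d} p = xorSum-cong N λ x → ∫-cong (p ∘ (_ ∷_))

    ∫-⊕ : (α β : Cochain d) → ∫ (α ⊕ β) ≡ ∫ α xor ∫ β
    ∫-⊕ {zero} α β = refl
    ∫-⊕ {suc d} α β = trans (xorSum-cong N λ x → ∫-⊕ (α at (true , x)) (β at (true , x)))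
      (xorSum-⊕ N (λ x → ∫ (α at (true , x))) (λ x → ∫ (β at (true , x))))

    private
      top : Vec ℕ d → Face d
      top [] = []
      top (x ∷ v) = (true , x) ∷ top v

    ∫-zero : (α : Cochain d) → (∀ v → α (top v) ≡ false) → ∫ α ≡ false
    ∫-zero {zero} α p = p []
    ∫-zero {suc d} α p = xorSum-zero N λ x → ∫-zero _ (p ∘ (x ∷_))

    facet : Fin d → ℕ → Subcomplex d
    facet k e i = record
      { has = λ c → i ≡ k → c ≡ (false , e)
      ; closed = λ p → (λ i≡k → case p i≡k of λ ()) , (λ i≡k → case p i≡k of λ ())
      }

    VanishesOnBoundary : Cochain d → Set
    VanishesOnBoundary α = ∀ k → VanishesOn (facet k 0) α × VanishesOn (facet k N) α

    -- Faces interior to the first direction telescope. Kept apart from `stokes` because `∫Π∂≡1`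
    -- applies it to a cochain that survives on the facet at `N`.
    stokes-step : (γ : Cochain (suc d)) →
      ∫ (∂ γ) ≡ xorSum N (λ x → ∫ (∂ (γ at (true , x)))) xor
                (∫ (γ at (false , N)) xor ∫ (γ at (false , 0)))
    stokes-step γ = trans
      (xorSum-cong N λ x → trans
        (∫-⊕ (∂ (γ at (true , x))) (γ at (false , suc x) ⊕ γ at (false , x)))
        (cong (∫ (∂ (γ at (true , x))) xor_) (∫-⊕ (γ at (false , suc x)) (γ at (false , x)))))
      (xorSum-telescope N (λ x → ∫ (∂ (γ at (true , x)))) (λ x → ∫ (γ at (false , x))))

    private
      slice-vanishes : (γ : Cochain (suc d)) (k : Fin d) (e : ℕ) (c : Cell) →
        VanishesOn (facet (suc k) e) γ → VanishesOn (facet k e) (γ at c)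
      slice-vanishes γ k e c p F F∈ = p _ λ where
        zero    ()
        (suc i) refl → F∈ i refl

      end-vanishes : (γ : Cochain (suc d)) (e : ℕ) →
        VanishesOn (facet zero e) γ → ∀ F → γ ((false , e) ∷ F) ≡ false
      end-vanishes γ e p F = p _ λ where
        zero    _  → refl
        (suc i) ()

    stokes : (γ : Cochain d) → VanishesOnBoundary γ → ∫ (∂ γ) ≡ false
    stokes {zero} γ p = refl
    stokes {suc d} γ p = trans (stokes-step γ) (cong₂ _xor_
      (xorSum-zero N λ x → stokes _ λ k →
        slice-vanishes γ k 0 _ (proj₁ (p (suc k))) , slice-vanishes γ k N _ (proj₂ (p (suc k))))
      (cong₂ _xor_ (∫-zero _ (λ v → end-vanishes γ N (proj₂ (p zero)) (top v)))
                   (∫-zero _ (λ v → end-vanishes γ 0 (proj₁ (p zero)) (top v)))))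

    -- The conditions are imposed on all vertices, including those with coordinates beyond `N`;
    -- clamping the grid to the box is what makes them available there.
    record Miranda (a : Fin d → Vec ℕ d → Bool) : Set where
      field
        low  : ∀ k v → lookup v k ≡ 0 → a k v ≡ false
        high : ∀ k v → lookup v k ≡ N → a k v ≡ true

    open Miranda

    ⌣-one : (a : Vec ℕ d → Bool) → (∀ v → a v ≡ true) → (β : Cochain d) → ⟪ a ⟫ ⌣ β ≗ β
    ⌣-one a p β [] = cong (_∧ β []) (p [])
    ⌣-one a p β ((false , x) ∷ F) = ⌣-one _ (p ∘ (x ∷_)) _ F
    ⌣-one a p β ((true , x) ∷ F) = trans
      (cong₂ _xor_ (⌣-one _ (p ∘ (x ∷_)) _ F) (⌣-zeroˡ _ _ (λ _ → refl) F))
      (solve 1 (λ b → b :+ con false := b) refl _)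

    -- By the Leibniz rule Π∂ a = ∂ (a₀ ⌣ ∂a₁ ⌣ … ), and of the boundary terms
    -- only the one on the facet where a₀ = 1 survives.
    ∫Π∂≡1 : (a : Fin d → Vec ℕ d → Bool) → Miranda a → ∫ (Π∂ a) ≡ true
    ∫Π∂≡1 {zero} a M = refl
    ∫Π∂≡1 {suc d} a M = trans (∫-cong Π∂≗∂γ) (trans (stokes-step γ) (cong₂ _xor_
        -- On a facet in another direction some `a (suc k)` is constant, so its coboundary already
        -- kills `γ`.
        (xorSum-zero N λ x → stokes (γ at (true , x)) λ k →
          slice-vanishes γ k 0 (true , x) (side k 0 false (low M (suc k))) ,
          slice-vanishes γ k N (true , x) (side k N true (high M (suc k))))
        (cong₂ _xor_
          -- On the facet at `N` the factor `a zero` is the unit, and what remains is the same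
          -- statement one dimension lower for the other functions.
          (trans (∫-cong λ F → trans (⌣-one _ (λ v → high M zero _ refl) _ F) (Π∂-slice (a ∘ suc) N F))
            (∫Π∂≡1 (λ k v → a (suc k) (N ∷ v)) record
              { low  = λ k v → low M (suc k) _
              ; high = λ k v → high M (suc k) _ }))
          (∫-zero (γ at (false , 0)) λ v → ⌣-zeroˡ (⟪ a zero ⟫ at (false , 0)) (β at (false , 0))
            (⟪⟫-false (λ u → low M zero (0 ∷ u) refl)) (top v)))))
      where
      β γ : Cochain (suc d)
      β = Π∂ (a ∘ suc)
      γ = ⟪ a zero ⟫ ⌣ β

      Π∂≗∂γ : Π∂ a ≗ ∂ γ
      Π∂≗∂γ F = sym (trans (leibniz ⟪ a zero ⟫ β F)
        (trans (cong ((∂ ⟪ a zero ⟫ ⌣ β) F xor_) (⌣-zeroʳ ⟪ a zero ⟫ _ (∂Π∂ (a ∘ suc)) F))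
          (solve 1 (λ b → b :+ con false := b) refl _)))

      ⟪⟫-false : ∀ {d} {a : Vec ℕ d → Bool} → (∀ v → a v ≡ false) → ∀ F → ⟪ a ⟫ F ≡ false
      ⟪⟫-false p [] = p []
      ⟪⟫-false p ((false , x) ∷ F) = ⟪⟫-false (p ∘ (x ∷_)) F
      ⟪⟫-false p ((true , x) ∷ F) = refl

      side : ∀ k e b → (∀ v → lookup v (suc k) ≡ e → a (suc k) v ≡ b) → VanishesOn (facet (suc k) e) γ
      side k e b p = ⌣-vanishesʳ (facet (suc k) e) _ _
        (Π∂-vanishes (facet (suc k) e) (a ∘ suc) k b
          (λ v v∈ → p v (cong proj₂ (v∈ (suc k) refl))))

    unitCube : Vec ℕ d → Subcomplex d
    unitCube v i = record
      { has = λ (b , x) → x ≡ lookup v i ⊎ (b ≡ false × x ≡ suc (lookup v i))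
      ; closed = λ { (inj₁ refl) → inj₁ refl , inj₂ (refl , refl) }
      }

    -- Constancy of one `a k` on the unit cube at `v` makes `Π∂ a` vanish on the top cell at `v`;
    -- constancy on every cube would therefore give the integral 0 instead of 1.
    miranda : (a : Fin d → Vec ℕ d → Bool) → Miranda a →
      ¬ (∀ v → ∃ λ k → ∃ λ b →
          ∀ u → (∀ i → lookup u i ≡ lookup v i ⊎ lookup u i ≡ suc (lookup v i)) → a k u ≡ b)
    miranda a M p with trans (sym (∫Π∂≡1 a M)) (∫-zero (Π∂ a) vanish)
      where
      top-∈ : ∀ {d} (v : Vec ℕ d) → top v ∈ᶠ unitCube v
      top-∈ (x ∷ v) zero = inj₁ refl
      top-∈ (x ∷ v) (suc i) = top-∈ v i

      weaken : ∀ {A B C : Set} → A ⊎ (B × C) → A ⊎ C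
      weaken (inj₁ a) = inj₁ a
      weaken (inj₂ (_ , c)) = inj₂ c

      vanish : ∀ v → Π∂ a (top v) ≡ false
      vanish v with k , b , q ← p v =
        Π∂-vanishes (unitCube v) a k b (λ u u∈ → q u (λ i → weaken (u∈ i))) (top v) (top-∈ v)
    ... | ()

-- A ring solver with integer coefficients

module IntegerCoefficients (R : CommutativeRing 0ℓ 0ℓ) where

  open CommutativeRing R
  open Mult semiring using (×-homo-+; ×1-homo-*) renaming (_×_ to _·_)
  open RingProperties ring using (-‿involutive; -0#≈0#; -‿distribˡ-*; -‿distribʳ-*)
  open AbelianGroupProperties +-abelianGroup using () renaming (⁻¹-∙-comm to -‿+-comm)
  open SetoidReasoning setoid

  ⟦_⟧ : ℤ → Carrier
  ⟦ + n ⟧ = n · 1#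
  ⟦ -[1+ n ] ⟧ = - (suc n · 1#)

  private
    suc-· : ∀ n → suc n · 1# ≈ 1# + n · 1#
    suc-· n = ×-homo-+ 1# 1 n

    cancel : ∀ x a b → (x + a) - (x + b) ≈ a - b
    cancel x a b = begin
      (x + a) + - (x + b)     ≈⟨ +-cong (+-comm x a) (sym (-‿+-comm x b)) ⟩
      (a + x) + (- x + - b)   ≈⟨ +-assoc a x _ ⟩
      a + (x + (- x + - b))   ≈⟨ +-congˡ (sym (+-assoc x (- x) (- b))) ⟩
      a + ((x + - x) + - b)   ≈⟨ +-congˡ (+-congʳ (-‿inverseʳ x)) ⟩
      a + (0# + - b)          ≈⟨ +-congˡ (+-identityˡ (- b)) ⟩
      a - b                   ∎

    ⊖-homo : ∀ m n → ⟦ m ℤ.⊖ n ⟧ ≈ m · 1# - n · 1#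
    ⊖-homo zero zero = sym (-‿inverseʳ 0#)
    ⊖-homo (suc m) zero = sym (trans (+-congˡ -0#≈0#) (+-identityʳ _))
    ⊖-homo zero (suc n) = sym (+-identityˡ _)
    ⊖-homo (suc m) (suc n) = begin
      ⟦ suc m ℤ.⊖ suc n ⟧                ≈⟨ reflexive (≡.cong ⟦_⟧ (ℤₚ.[1+m]⊖[1+n]≡m⊖n m n)) ⟩
      ⟦ m ℤ.⊖ n ⟧                        ≈⟨ ⊖-homo m n ⟩
      m · 1# - n · 1#                  ≈⟨ cancel 1# _ _ ⟨
      (1# + m · 1#) - (1# + n · 1#)    ≈⟨ +-cong (sym (suc-· m)) (-‿cong (sym (suc-· n))) ⟩
      suc m · 1# - suc n · 1#          ∎

    +-homo : ∀ i j → ⟦ i ℤ.+ j ⟧ ≈ ⟦ i ⟧ + ⟦ j ⟧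
    +-homo (+ m) (+ n) = ×-homo-+ 1# m n
    +-homo (+ m) -[1+ n ] = ⊖-homo m (suc n)
    +-homo -[1+ m ] (+ n) = trans (⊖-homo n (suc m)) (+-comm _ _)
    +-homo -[1+ m ] -[1+ n ] = begin
      - (suc (suc (m ℕ.+ n)) · 1#)       ≈⟨ -‿cong (reflexive (≡.cong (λ k → suc k · 1#) (≡.sym (ℕₚ.+-suc m n)))) ⟩
      - ((suc m ℕ.+ suc n) · 1#)         ≈⟨ -‿cong (×-homo-+ 1# (suc m) (suc n)) ⟩
      - (suc m · 1# + suc n · 1#)        ≈⟨ -‿+-comm _ _ ⟨
      - (suc m · 1#) + - (suc n · 1#)    ∎

    neg-homo : ∀ i → ⟦ ℤ.- i ⟧ ≈ - ⟦ i ⟧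
    neg-homo (+ zero) = sym -0#≈0#
    neg-homo (+ suc n) = refl
    neg-homo -[1+ n ] = sym (-‿involutive _)

    pos-*-homo : ∀ m n → ⟦ + m ℤ.* + n ⟧ ≈ ⟦ + m ⟧ * ⟦ + n ⟧
    pos-*-homo m n = trans (reflexive (≡.cong ⟦_⟧ (≡.sym (ℤₚ.pos-* m n)))) (×1-homo-* m n)

    pos-homo : ∀ m j → ⟦ + m ℤ.* j ⟧ ≈ ⟦ + m ⟧ * ⟦ j ⟧
    pos-homo m (+ n) = pos-*-homo m n
    pos-homo m -[1+ n ] = begin
      ⟦ + m ℤ.* -[1+ n ] ⟧         ≈⟨ reflexive (≡.cong ⟦_⟧ (≡.sym (ℤₚ.neg-distribʳ-* (+ m) (+ suc n)))) ⟩
      ⟦ ℤ.- (+ m ℤ.* + suc n) ⟧    ≈⟨ neg-homo (+ m ℤ.* + suc n) ⟩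
      - ⟦ + m ℤ.* + suc n ⟧        ≈⟨ -‿cong (pos-*-homo m (suc n)) ⟩
      - (⟦ + m ⟧ * ⟦ + suc n ⟧)    ≈⟨ -‿distribʳ-* _ _ ⟩
      ⟦ + m ⟧ * - ⟦ + suc n ⟧      ∎

    *-homo : ∀ i j → ⟦ i ℤ.* j ⟧ ≈ ⟦ i ⟧ * ⟦ j ⟧
    *-homo (+ m) j = pos-homo m j
    *-homo -[1+ m ] j = begin
      ⟦ -[1+ m ] ℤ.* j ⟧           ≈⟨ reflexive (≡.cong ⟦_⟧ (≡.sym (ℤₚ.neg-distribˡ-* (+ suc m) j))) ⟩
      ⟦ ℤ.- (+ suc m ℤ.* j) ⟧      ≈⟨ neg-homo (+ suc m ℤ.* j) ⟩
      - ⟦ + suc m ℤ.* j ⟧          ≈⟨ -‿cong (pos-homo (suc m) j) ⟩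
      - (⟦ + suc m ⟧ * ⟦ j ⟧)      ≈⟨ -‿distribˡ-* _ _ ⟩
      - ⟦ + suc m ⟧ * ⟦ j ⟧        ∎

  -- Equality in `R` is not decidable, so the solver compares coefficients as integers and
  -- transports them into `R` along this homomorphism.
  morphism : ℤ.+-*-rawRing -Raw-AlmostCommutative⟶ fromCommutativeRing R
  morphism = record
    { ⟦_⟧ = ⟦_⟧ ; +-homo = +-homo ; *-homo = *-homo ; -‿homo = neg-homo
    ; 0-homo = refl ; 1-homo = refl }

  _≟ᶜ_ : ∀ i j → Maybe (⟦ i ⟧ ≈ ⟦ j ⟧)
  i ≟ᶜ j with i ℤₚ.≟ j
  ... | yes i≡j = just (reflexive (≡.cong ⟦_⟧ i≡j))
  ... | no _    = nothing

  open RingSolver ℤ.+-*-rawRing (fromCommutativeRing R) morphism _≟ᶜ_ public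
    using (solve; con; _:=_; _:+_; _:*_; _:-_; :-_)

-- Arithmetic in a complete ordered field

module Proof (em : ExcludedMiddle (lsuc 0ℓ)) (ℝ : CompleteOrderedField) where

  open CompleteOrderedField ℝ hiding (zero; _<_)
  open IntegerCoefficients commutativeRing
  open Euclidean ℝ
  open RawMonoidDefs +-rawMonoid using () renaming (_×_ to _·_)
  open Sum semiring using (sum; sum-cong-≋)

  private variable
    d n : ℕ

  -- `em` lives one universe up because the set of values in `IsSupInf` quantifies over `Subset d`;
  -- small propositions are lifted to it.
  em₀ : (P : Set) → Dec P
  em₀ P with em {Lift (lsuc 0ℓ) P}
  ... | yes p = yes (lower p)
  ... | no ¬p = no (λ p → ¬p (lift p))

  infix 4 _≺_
  -- Equivalent to `_<_` by totality and antisymmetry, but a single negation, which suits the many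
  -- arguments by contradiction.
  _≺_ : Carrier → Carrier → Set
  x ≺ y = ¬ (y ≤ x)

  ≤-or-≻ : ∀ x y → x ≤ y ⊎ y ≺ x
  ≤-or-≻ x y with em₀ (x ≤ y)
  ... | yes p = inj₁ p
  ... | no ¬p = inj₂ ¬p

  ≺⇒≤ : ∀ {x y} → x ≺ y → x ≤ y
  ≺⇒≤ {x} {y} x≺y = [ (λ p → p) , (λ p → ⊥-elim (x≺y p)) ]′ (total x y)

  ≤-≺-trans : ∀ {x y z} → x ≤ y → y ≺ z → x ≺ z
  ≤-≺-trans p q z≤x = q (≤-trans z≤x p)

  ≺-≤-trans : ∀ {x y z} → x ≺ y → y ≤ z → x ≺ z
  ≺-≤-trans p q z≤x = p (≤-trans q z≤x)

  ≺-respʳ : ∀ {x y z} → y ≈ z → x ≺ y → x ≺ z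
  ≺-respʳ y≈z x≺y z≤x = x≺y (≤-respˡ-≈ (sym y≈z) z≤x)

  ≤⇒0≤ : ∀ {x y} → x ≤ y → 0# ≤ y - x
  ≤⇒0≤ {x} x≤y = ≤-respˡ-≈ (-‿inverseʳ x) (+-monoˡ-≤ (- x) x≤y)

  -- The pattern of most inequalities below: exhibit the difference as an expression `e` that is
  -- visibly nonnegative, and leave `e ≈ y - x` to the ring solver.
  0≤⇒≤ : ∀ {x y e} → 0# ≤ e → e ≈ y - x → x ≤ y
  0≤⇒≤ {x} {y} 0≤e e≈ = ≤-respˡ-≈ (+-identityˡ x)
    (≤-respʳ-≈ (solve 2 (λ x y → (y :- x) :+ x := y) refl x y) (+-monoˡ-≤ x (≤-respʳ-≈ e≈ 0≤e)))

  ≺⇒0≺ : ∀ {x y} → x ≺ y → 0# ≺ y - x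
  ≺⇒0≺ {x} {y} x≺y p = x≺y (0≤⇒≤ (≤⇒0≤ p) (solve 2 (λ x y → con (+ 0) :- (y :- x) := x :- y) refl x y))

  0≺⇒≺ : ∀ {x y e} → 0# ≺ e → e ≈ y - x → x ≺ y
  0≺⇒≺ {x} {y} {e} 0≺e e≈ y≤x = 0≺e (0≤⇒≤ (≤⇒0≤ y≤x)
    (trans (solve 2 (λ x y → x :- y := con (+ 0) :- (y :- x)) refl x y) (+-congˡ (-‿cong (sym e≈)))))

  +-nonneg : ∀ {x y} → 0# ≤ x → 0# ≤ y → 0# ≤ x + y
  +-nonneg {x} {y} 0≤x 0≤y = ≤-trans 0≤y (≤-respˡ-≈ (+-identityˡ y) (+-monoˡ-≤ y 0≤x))

  +-posˡ : ∀ {x y} → 0# ≺ x → 0# ≤ y → 0# ≺ x + y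
  +-posˡ {x} {y} 0≺x 0≤y p = 0≺x (0≤⇒≤ (+-nonneg (≤⇒0≤ p) 0≤y)
    (solve 2 (λ x y → (con (+ 0) :- (x :+ y)) :+ y := con (+ 0) :- x) refl x y))

  +-posʳ : ∀ {x y} → 0# ≤ x → 0# ≺ y → 0# ≺ x + y
  +-posʳ 0≤x 0≺y = ≺-respʳ (+-comm _ _) (+-posˡ 0≺y 0≤x)

  +-mono-≤ : ∀ {x y u v} → x ≤ y → u ≤ v → x + u ≤ y + v
  +-mono-≤ p q = 0≤⇒≤ (+-nonneg (≤⇒0≤ p) (≤⇒0≤ q))
    (solve 4 (λ x y u v → (y :- x) :+ (v :- u) := (y :+ v) :- (x :+ u)) refl _ _ _ _)

  neg-mono : ∀ {x y} → x ≤ y → - y ≤ - x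
  neg-mono p = 0≤⇒≤ (≤⇒0≤ p) (solve 2 (λ x y → y :- x := :- x :- :- y) refl _ _)

  *-monoˡ-≤ : ∀ {c x y} → 0# ≤ c → x ≤ y → c * x ≤ c * y
  *-monoˡ-≤ 0≤c p = 0≤⇒≤ (*-nonneg 0≤c (≤⇒0≤ p))
    (solve 3 (λ c x y → c :* (y :- x) := c :* y :- c :* x) refl _ _ _)

  square-nonneg : ∀ x → 0# ≤ x * x
  square-nonneg x with total 0# x
  ... | inj₁ 0≤x = *-nonneg 0≤x 0≤x
  ... | inj₂ x≤0 = ≤-respʳ-≈ (solve 1 (λ x → (con (+ 0) :- x) :* (con (+ 0) :- x) := x :* x) refl x)
                     (*-nonneg (≤⇒0≤ x≤0) (≤⇒0≤ x≤0))

  0≤1 : 0# ≤ 1#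
  0≤1 = ≤-respʳ-≈ (*-identityˡ 1#) (square-nonneg 1#)

  0≺1 : 0# ≺ 1#
  0≺1 1≤0 = 0≉1 (≤-antisym 0≤1 1≤0)

  ≻⇒≉ : ∀ {x} → 0# ≺ x → ¬ (x ≈ 0#)
  ≻⇒≉ 0≺x x≈0 = 0≺x (≤-reflexive x≈0)

  -- Total, with default value 0 at 0, so that `mean` is a function on all of space even where the
  -- total weight vanishes.
  recip : Carrier → Carrier
  recip x with em₀ (x ≈ 0#)
  ... | yes _ = 0#
  ... | no x≉0 = proj₁ (inverse x x≉0)

  *-recip : ∀ {x} → 0# ≺ x → x * recip x ≈ 1#
  *-recip {x} 0≺x with em₀ (x ≈ 0#)
  ... | yes x≈0 = ⊥-elim (≻⇒≉ 0≺x x≈0)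
  ... | no x≉0 = proj₂ (inverse x x≉0)

  recip-pos : ∀ {x} → 0# ≺ x → 0# ≺ recip x
  recip-pos {x} 0≺x r≤0 = 0≺1 (0≤⇒≤ (*-nonneg (≺⇒≤ 0≺x) (≤⇒0≤ r≤0))
    (trans (solve 2 (λ x r → x :* (con (+ 0) :- r) := con (+ 0) :- x :* r) refl x (recip x))
      (+-congˡ (-‿cong (*-recip 0≺x)))))

  recip-nonneg : ∀ {x} → 0# ≺ x → 0# ≤ recip x
  recip-nonneg 0≺x = ≺⇒≤ (recip-pos 0≺x)

  *-pos : ∀ {x y} → 0# ≺ x → 0# ≺ y → 0# ≺ x * y
  *-pos {x} {y} 0≺x 0≺y xy≤0 = 0≺x (0≤⇒≤ (*-nonneg (≤⇒0≤ xy≤0) (recip-nonneg 0≺y))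
    (trans (solve 3 (λ x y r → (con (+ 0) :- x :* y) :* r := con (+ 0) :- x :* (y :* r)) refl x y (recip y))
      (+-congˡ (-‿cong (trans (*-congˡ (*-recip 0≺y)) (*-identityʳ x))))))

  0≺2 : 0# ≺ 2#
  0≺2 = +-posˡ 0≺1 0≤1

  abstract
    halve : ∀ {ε} → 0# ≺ ε → ∃ λ η → 0# ≺ η × η + η ≈ ε
    halve {ε} 0≺ε = ε * recip 2# , *-pos 0≺ε (recip-pos 0≺2) ,
      trans (solve 2 (λ e r → e :* r :+ e :* r := e :* (con (+ 2) :* r)) refl ε (recip 2#))
        (trans (*-congˡ (*-recip 0≺2)) (*-identityʳ ε))

  pos-min : ∀ {x y} → 0# ≺ x → 0# ≺ y → ∃ λ z → 0# ≺ z × z ≤ x × z ≤ y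
  pos-min {x} {y} 0≺x 0≺y with total x y
  ... | inj₁ x≤y = x , 0≺x , ≤-refl , x≤y
  ... | inj₂ y≤x = y , 0≺y , y≤x , ≤-refl

  upper : ∀ x y → ∃ λ z → x ≤ z × y ≤ z
  upper x y with total x y
  ... | inj₁ x≤y = y , x≤y , ≤-refl
  ... | inj₂ y≤x = x , ≤-refl , y≤x

  square-mono : ∀ {x y} → 0# ≤ x → x ≤ y → x * x ≤ y * y
  square-mono {x} {y} 0≤x x≤y = 0≤⇒≤ (*-nonneg (≤⇒0≤ x≤y) (+-nonneg 0≤x (≤-trans 0≤x x≤y)))
    (solve 2 (λ x y → (y :- x) :* (x :+ y) := y :* y :- x :* x) refl x y)

  square-mono-≺ : ∀ {x y} → 0# ≤ x → x ≺ y → x * x ≺ y * y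
  square-mono-≺ {x} {y} 0≤x x≺y = 0≺⇒≺
    (*-pos (≺⇒0≺ x≺y) (+-posʳ 0≤x (≤-≺-trans 0≤x x≺y)))
    (solve 2 (λ x y → (y :- x) :* (x :+ y) := y :* y :- x :* x) refl x y)

  square-cancel-≤ : ∀ {x y} → 0# ≤ y → x * x ≤ y * y → x ≤ y
  square-cancel-≤ {x} {y} 0≤y p with ≤-or-≻ x y
  ... | inj₁ q = q
  ... | inj₂ q = ⊥-elim (square-mono-≺ 0≤y q p)

  infimum : (S : Pred Carrier 0ℓ) → Satisfiable S → ∃ (LowerBound S) → ∃ (IsInf S)
  infimum S (x , x∈S) bounded with s , ub , least ← complete (LowerBound S) bounded (x , λ b lb → lb x x∈S) =
    s , (λ y y∈S → least y (λ b lb → lb y y∈S)) , ub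

  infimum-≺ : (S : Pred Carrier 0ℓ) {r b : Carrier} → IsInf S r → r ≺ b → ∃ λ x → x ∈ S × x ≺ b
  infimum-≺ S {r} {b} (_ , greatest) r≺b with em₀ (∃ λ x → x ∈ S × x ≺ b)
  ... | yes p = p
  ... | no ¬p = ⊥-elim (r≺b (greatest b λ x x∈S →
    [ (λ q → q) , (λ q → ⊥-elim (¬p (x , x∈S , q))) ]′ (≤-or-≻ b x)))

  supremum-≻ : (S : Pred Carrier 0ℓ) {r b : Carrier} → IsSup S r → b ≺ r → ∃ λ x → x ∈ S × b ≺ x
  supremum-≻ S {r} {b} (_ , least) b≺r with em₀ (∃ λ x → x ∈ S × b ≺ x)
  ... | yes p = p
  ... | no ¬p = ⊥-elim (b≺r (least b λ x x∈S →
    [ (λ q → q) , (λ q → ⊥-elim (¬p (x , x∈S , q))) ]′ (≤-or-≻ x b)))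


  x-y≺x : ∀ {x y} → 0# ≺ y → x - y ≺ x
  x-y≺x 0≺y = 0≺⇒≺ 0≺y (solve 2 (λ x y → y := x :- (x :- y)) refl _ _)

  x≺x+y : ∀ {x y} → 0# ≺ y → x ≺ x + y
  x≺x+y 0≺y = 0≺⇒≺ 0≺y (solve 2 (λ x y → y := (x :+ y) :- x) refl _ _)

  -- Otherwise the multiples of `ε` have a supremum `s`; some multiple exceeds `s - ε`, and the next
  -- one exceeds `s`.
  archimedean : ∀ {ε} → 0# ≺ ε → ∀ b → ∃ λ n → b ≤ n · ε
  archimedean {ε} 0≺ε b with em₀ (∃ λ n → b ≤ n · ε)
  ... | yes p = p
  ... | no ¬p = ⊥-elim (contra (supremum-≻ S isSup (x-y≺x 0≺ε)))
    where
    S : Pred Carrier 0ℓ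
    S x = ∃ λ n → x ≈ n · ε
    S-sup : ∃ (IsSup S)
    S-sup = complete S (0# , 0 , refl) (b , λ { x (n , x≈) → ≤-respˡ-≈ (sym x≈) (≺⇒≤ (λ p → ¬p (n , p))) })
    s : Carrier
    s = proj₁ S-sup
    isSup : IsSup S s
    isSup = proj₂ S-sup
    contra : ¬ (∃ λ x → x ∈ S × s - ε ≺ x)
    contra (x , (n , x≈) , s-ε≺x) = s-ε≺x (0≤⇒≤ (≤⇒0≤ (proj₁ isSup (suc n · ε) (suc n , refl)))
      (trans (solve 3 (λ s e m → s :- (e :+ m) := (s :- e) :- m) refl s ε (n · ε))
        (+-congˡ (-‿cong (sym x≈)))))

  -- Square roots

  √-nonneg : ∀ x → 0# ≤ √ x
  √-nonneg x = proj₁ (√-isSup x) 0# (inj₁ ≤-refl)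

  √-mono : ∀ {x y} → x ≤ y → √ x ≤ √ y
  √-mono {x} {y} x≤y = proj₂ (√-isSup x) (√ y) λ where
    z (inj₁ z≤0)  → proj₁ (√-isSup y) z (inj₁ z≤0)
    z (inj₂ z²≤x) → proj₁ (√-isSup y) z (inj₂ (≤-trans z²≤x x≤y))

  ≤²⇒√≤ : ∀ {x M} → 0# ≤ M → x ≤ M * M → √ x ≤ M
  ≤²⇒√≤ {x} {M} 0≤M x≤M² = proj₂ (√-isSup x) M λ where
    z (inj₁ z≤0)  → ≤-trans z≤0 0≤M
    z (inj₂ z²≤x) → square-cancel-≤ 0≤M (≤-trans z²≤x x≤M²)

  1≤⇒1≤√ : ∀ {x} → 1# ≤ x → 1# ≤ √ x
  1≤⇒1≤√ {x} 1≤x = proj₁ (√-isSup x) 1# (inj₂ (≤-respˡ-≈ (sym (*-identityˡ 1#)) 1≤x))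

  -- If M² < x then (M + h)² ≤ M² + (2M + 1)h ≤ x for small 0 < h ≤ 1.
  √≤⇒≤² : ∀ {x M} → 0# ≤ M → √ x ≤ M → x ≤ M * M
  √≤⇒≤² {x} {M} 0≤M √x≤M with ≤-or-≻ x (M * M)
  ... | inj₁ p = p
  ... | inj₂ M²≺x = ⊥-elim (x≺x+y 0≺h (≤-trans (proj₁ (√-isSup x) (M + h) (inj₂ bound)) √x≤M))
    where
    K : Carrier
    K = M + M + 1#
    0≺K : 0# ≺ K
    0≺K = +-posʳ (+-nonneg 0≤M 0≤M) 0≺1
    small : ∃ λ h → 0# ≺ h × h ≤ 1# × h ≤ (x - M * M) * recip K
    small = pos-min 0≺1 (*-pos (≺⇒0≺ M²≺x) (recip-pos 0≺K))
    h : Carrier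
    h = proj₁ small
    0≺h : 0# ≺ h
    0≺h = proj₁ (proj₂ small)
    hK≤ : K * h ≤ x - M * M
    hK≤ = ≤-trans (*-monoˡ-≤ (≺⇒≤ 0≺K) (proj₂ (proj₂ (proj₂ small))))
      (≤-reflexive (trans (solve 3 (λ k e r → k :* (e :* r) := e :* (k :* r)) refl K (x - M * M) (recip K))
        (trans (*-congˡ (*-recip 0≺K)) (*-identityʳ _))))
    bound : (M + h) * (M + h) ≤ x
    bound = 0≤⇒≤ (+-nonneg (≤⇒0≤ hK≤) (*-nonneg (≺⇒≤ 0≺h) (≤⇒0≤ (proj₁ (proj₂ (proj₂ small))))))
      (solve 3 (λ x M h → ((x :- M :* M) :- (M :+ M :+ con (+ 1)) :* h) :+ h :* (con (+ 1) :- h)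
                          := x :- (M :+ h) :* (M :+ h)) refl x M h)

  -- Two-sided bounds, neighbourhoods and boxes

  Within : Carrier → Carrier → Set
  Within ε x = - ε ≤ x × x ≤ ε

  within-resp : ∀ {ε x y} → x ≈ y → Within ε x → Within ε y
  within-resp x≈y (p , q) = ≤-respʳ-≈ x≈y p , ≤-respˡ-≈ x≈y q

  within-weaken : ∀ {ε η x} → ε ≤ η → Within ε x → Within η x
  within-weaken ε≤η (p , q) = ≤-trans (neg-mono ε≤η) p , ≤-trans q ε≤η

  within-0 : ∀ {ε} → 0# ≤ ε → Within ε 0#
  within-0 0≤ε = 0≤⇒≤ 0≤ε (solve 1 (λ e → e := con (+ 0) :- :- e) refl _) , 0≤ε

  within-neg : ∀ {ε x} → Within ε x → Within ε (- x)
  within-neg (p , q) = neg-mono q , 0≤⇒≤ (≤⇒0≤ p) (solve 2 (λ e x → x :- :- e := e :- :- x) refl _ _)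

  within-+ : ∀ {ε η x y} → Within ε x → Within η y → Within (ε + η) (x + y)
  within-+ (p , q) (p′ , q′) =
    ≤-respˡ-≈ (solve 2 (λ e h → :- e :+ :- h := :- (e :+ h)) refl _ _) (+-mono-≤ p p′) ,
    +-mono-≤ q q′

  double-cancel : ∀ {x} → 0# ≤ x + x → 0# ≤ x
  double-cancel {x} p with ≤-or-≻ 0# x
  ... | inj₁ q = q
  ... | inj₂ q = ⊥-elim (+-posˡ (≺⇒0≺ q) (≺⇒≤ (≺⇒0≺ q))
    (0≤⇒≤ p (solve 1 (λ x → x :+ x := con (+ 0) :- ((con (+ 0) :- x) :+ (con (+ 0) :- x))) refl x)))

  within⇒0≤ : ∀ {ε x} → Within ε x → 0# ≤ ε
  within⇒0≤ (p , q) = double-cancel (0≤⇒≤ (≤⇒0≤ (≤-trans p q))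
    (solve 1 (λ e → e :- :- e := e :+ e :- con (+ 0)) refl _))

  -- Each half adds two products of nonnegative factors whose cross terms cancel, leaving twice the
  -- required difference; `double-cancel` removes the factor 2.
  within-* : ∀ {ε η x y} → Within ε x → Within η y → Within (ε * η) (x * y)
  within-* {ε} {η} {x} {y} (p , q) (p′ , q′) =
    0≤⇒≤ (double-cancel (≤-respʳ-≈
      (solve 4 (λ e h x y → (e :- x) :* (h :- y) :+ (x :- :- e) :* (y :- :- h)
                            := (x :* y :- :- (e :* h)) :+ (x :* y :- :- (e :* h))) refl ε η x y)
      (+-nonneg (*-nonneg (≤⇒0≤ q) (≤⇒0≤ q′)) (*-nonneg (≤⇒0≤ p) (≤⇒0≤ p′))))) refl ,
    0≤⇒≤ (double-cancel (≤-respʳ-≈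
      (solve 4 (λ e h x y → (e :- x) :* (y :- :- h) :+ (x :- :- e) :* (h :- y)
                            := (e :* h :- x :* y) :+ (e :* h :- x :* y)) refl ε η x y)
      (+-nonneg (*-nonneg (≤⇒0≤ q) (≤⇒0≤ p′)) (*-nonneg (≤⇒0≤ p) (≤⇒0≤ q′))))) refl

  bounded : ∀ x → ∃ λ A → Within A x
  bounded x with upper x (- x)
  ... | A , x≤A , -x≤A = A , 0≤⇒≤ (≤⇒0≤ -x≤A) (solve 2 (λ a x → a :- :- x := x :- :- a) refl A x) , x≤A

  Near : Carrier → Point d → Pred (Point d) 0ℓ
  Near η z z′ = ∀ k → Within η (z′ k - z k)

  Box : Carrier → Pred (Point d) 0ℓ
  Box L z = ∀ k → Within L (z k)

  -- Compactness

  -- Heine-Borel as an induction principle on sets. Let `c` be the supremum of the `x` for which `P`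
  -- holds on [-L, x]. A neighbourhood of `c` on which `P` holds extends the interval past `c`,
  -- which is absurd unless it reaches `L`.
  compact₁ : (P : Pred Carrier 0ℓ → Set) →
    (∀ {U V} → U ⊆ V → P V → P U) → (∀ {U V} → P U → P V → P (U ∪ V)) →
    ∀ {L} → 0# ≤ L → (∀ x → Within L x → ∃ λ η → 0# ≺ η × P (λ u → Within η (u - x))) →
    P (Within L)
  compact₁ P mono union {L} 0≤L local = continue (complete S (- L , -L∈S) (L , L-bound))
    where
    S : Pred Carrier 0ℓ
    S x = Within L x × P (λ u → - L ≤ u × u ≤ x)

    -L≤L : - L ≤ L
    -L≤L = 0≤⇒≤ (+-nonneg 0≤L 0≤L) (solve 1 (λ l → l :+ l := l :- :- l) refl L)

    -L∈S : S (- L)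
    -L∈S with η , 0≺η , p ← local (- L) (≤-refl , -L≤L) =
      (≤-refl , -L≤L) ,
      mono (λ { (q , r) → within-resp (trans (sym (-‿inverseʳ (- L))) (+-congʳ (≤-antisym q r)))
                            (within-0 (≺⇒≤ 0≺η)) }) p

    L-bound : UpperBound S L
    L-bound x x∈S = proj₂ (proj₁ x∈S)

    extend : ∀ {c η} y → y ≤ c + η → P (λ u → Within η (u - c)) →
      (∃ λ x → x ∈ S × c - η ≺ x) → P (λ u → - L ≤ u × u ≤ y)
    extend {c} {η} y y≤c+η near (x , (_ , p) , c-η≺x) = mono cover (union p near)
      where
      cover : (λ u → - L ≤ u × u ≤ y) ⊆ (λ u → - L ≤ u × u ≤ x) ∪ (λ u → Within η (u - c))
      cover {u} (-L≤u , u≤y) with total u x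
      ... | inj₁ u≤x = inj₁ (-L≤u , u≤x)
      ... | inj₂ x≤u = inj₂
        ( 0≤⇒≤ (≤⇒0≤ (≤-trans (≺⇒≤ c-η≺x) x≤u)) (solve 3 (λ c h u → u :- (c :- h) := u :- c :- :- h) refl c η u)
        , 0≤⇒≤ (≤⇒0≤ (≤-trans u≤y y≤c+η)) (solve 3 (λ c h u → c :+ h :- u := h :- (u :- c)) refl c η u))

    continue : ∃ (IsSup S) → P (Within L)
    continue (c , isSup@(ub , least)) = conclude (local c c-within)
      where
      c-within : Within L c
      c-within = ub (- L) -L∈S , least L L-bound

      conclude : (∃ λ η → 0# ≺ η × P (λ u → Within η (u - c))) → P (Within L)
      conclude (η , 0≺η , near) with ≤-or-≻ L (c + η)
      ... | inj₁ L≤c+η = extend L L≤c+η near (supremum-≻ S isSup (x-y≺x 0≺η))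
      ... | inj₂ c+η≺L = ⊥-elim (x≺x+y 0≺η (ub (c + η)
        ( (≤-trans (proj₁ c-within) (≺⇒≤ (x≺x+y 0≺η)) , ≺⇒≤ c+η≺L)
        , extend (c + η) ≤-refl near (supremum-≻ S isSup (x-y≺x 0≺η)))))

  -- The tube lemma: for a fixed first coordinate, compactness of the remaining box yields a slab of
  -- positive width, the unions being handled by taking the smaller width. `compact₁` then glues the
  -- slabs.
  compact : (P : Pred (Point d) 0ℓ → Set) →
    (∀ {U V} → U ⊆ V → P V → P U) → (∀ {U V} → P U → P V → P (U ∪ V)) →
    ∀ {L} → 0# ≤ L → (∀ z → Box L z → ∃ λ η → 0# ≺ η × P (Near η z)) →
    P (Box L)
  compact {zero} P mono union 0≤L local with _ , _ , p ← local (λ ()) (λ ()) = mono (λ _ ()) p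
  compact {suc d} P mono union {L} 0≤L local =
    mono (λ z∈ → z∈ zero , z∈ ∘ suc)
      (compact₁ (λ U → P (λ z → U (head z) × Box L (tail z)))
        (λ U⊆V → mono (λ { (p , q) → U⊆V p , q }))
        (λ p q → mono (λ { (inj₁ u , v) → inj₁ (u , v) ; (inj₂ u , v) → inj₂ (u , v) }) (union p q))
        0≤L slab)
    where
    slab : ∀ x → Within L x →
      ∃ λ η → 0# ≺ η × P (λ z → Within η (head z - x) × Box L (tail z))
    slab x x∈ = compact (λ V → ∃ λ η → 0# ≺ η × P (λ z → Within η (head z - x) × V (tail z)))
      (λ { U⊆V (η , 0≺η , p) → η , 0≺η , mono (λ { (u , v) → u , U⊆V v }) p })
      (λ { {U} {V} (η , 0≺η , p) (η′ , 0≺η′ , p′) → case-min {U} {V} {η = η} {η′} p p′ (pos-min 0≺η 0≺η′) })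
      0≤L
      (λ z z∈ → case-local (local (x ◂ z) λ { zero → x∈ ; (suc k) → z∈ k }))
      where
      case-min : ∀ {U V η η′} →
        P (λ z → Within η (head z - x) × U (tail z)) → P (λ z → Within η′ (head z - x) × V (tail z)) →
        (∃ λ ζ → 0# ≺ ζ × ζ ≤ η × ζ ≤ η′) →
        ∃ λ ζ → 0# ≺ ζ × P (λ z → Within ζ (head z - x) × (U ∪ V) (tail z))
      case-min p p′ (ζ , 0≺ζ , ζ≤η , ζ≤η′) = ζ , 0≺ζ , mono
        (λ { (u , inj₁ v) → inj₁ (within-weaken ζ≤η u , v)
           ; (u , inj₂ v) → inj₂ (within-weaken ζ≤η′ u , v) }) (union p p′)

      case-local : ∀ {z} → (∃ λ η → 0# ≺ η × P (Near η (x ◂ z))) →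
        ∃ λ ζ → 0# ≺ ζ × ∃ λ η → 0# ≺ η × P (λ z′ → Within η (head z′ - x) × Near ζ z (tail z′))
      case-local (η , 0≺η , p) = η , 0≺η , η , 0≺η ,
        mono (λ { (u , v) → λ { zero → u ; (suc k) → v k } }) p

  -- Continuity at a point

  Eventually : Point d → Pred (Point d) 0ℓ → Set
  Eventually z Q = ∃ λ η → 0# ≺ η × Near η z ⊆ Q

  eventually-map : ∀ {z : Point d} {Q R : Pred (Point d) 0ℓ} → Q ⊆ R → Eventually z Q → Eventually z R
  eventually-map f (η , 0≺η , p) = η , 0≺η , λ n → f (p n)

  eventually-zip : ∀ {z : Point d} {Q R T : Pred (Point d) 0ℓ} →
    (∀ {z′} → Q z′ → R z′ → T z′) → Eventually z Q → Eventually z R → Eventually z T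
  eventually-zip f (η , 0≺η , p) (η′ , 0≺η′ , p′) with ζ , 0≺ζ , ζ≤η , ζ≤η′ ← pos-min 0≺η 0≺η′ =
    ζ , 0≺ζ , λ n → f (p (λ k → within-weaken ζ≤η (n k))) (p′ (λ k → within-weaken ζ≤η′ (n k)))

  ContinuousAt : Point d → (Point d → Carrier) → Set
  ContinuousAt z f = ∀ ε → 0# ≺ ε → Eventually z (λ z′ → Within ε (f z′ - f z))

  continuous-const : ∀ {z : Point d} x → ContinuousAt z (λ _ → x)
  continuous-const x ε 0≺ε = 1# , 0≺1 , λ _ → within-resp (sym (-‿inverseʳ x)) (within-0 (≺⇒≤ 0≺ε))

  continuous-coordinate : ∀ {z : Point d} k → ContinuousAt z (λ s → s k)
  continuous-coordinate k ε 0≺ε = ε , 0≺ε , λ n → n k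

  continuous-+ : ∀ {z : Point d} {f g} → ContinuousAt z f → ContinuousAt z g → ContinuousAt z (λ s → f s + g s)
  continuous-+ F G ε 0≺ε with η , 0≺η , η+η≈ε ← halve 0≺ε =
    eventually-zip (λ p q → within-weaken (≤-reflexive η+η≈ε)
      (within-resp (solve 4 (λ a b c e → (a :- b) :+ (c :- e) := (a :+ c) :- (b :+ e)) refl _ _ _ _) (within-+ p q)))
      (F η 0≺η) (G η 0≺η)

  continuous-neg : ∀ {z : Point d} {f} → ContinuousAt z f → ContinuousAt z (λ s → - f s)
  continuous-neg F ε 0≺ε = eventually-map
    (λ p → within-resp (solve 2 (λ a b → :- (a :- b) := :- a :- :- b) refl _ _) (within-neg p)) (F ε 0≺ε)

  private
    scale : ∀ {x K e} → 0# ≺ K → x ≤ e * recip K → K * x ≤ e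
    scale {K = K} {e} 0≺K p = ≤-respʳ-≈
      (trans (solve 3 (λ k e r → k :* (e :* r) := e :* (k :* r)) refl K e (recip K))
        (trans (*-congˡ (*-recip 0≺K)) (*-identityʳ e)))
      (*-monoˡ-≤ (≺⇒≤ 0≺K) p)

  -- With both increments within `ρ`, the increment Δf Δg + f Δg + Δf g is within ρ² + Aρ + ρB,
  -- which is at most `K * ρ` because ρ ≤ 1.
  continuous-* : ∀ {z : Point d} {f g} → ContinuousAt z f → ContinuousAt z g → ContinuousAt z (λ s → f s * g s)
  continuous-* {z = z} {f} {g} F G ε 0≺ε =
    eventually-zip (λ p q → within-weaken ρ-bound (within-resp
        (solve 4 (λ a b c e → (a :- b) :* (c :- e) :+ (b :* (c :- e) :+ (a :- b) :* e) := a :* c :- b :* e) refl _ _ _ _)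
        (within-+ (within-* p q) (within-+ (within-* A-bound q) (within-* p B-bound)))))
      (F ρ 0≺ρ) (G ρ 0≺ρ)
    where
    A B K : Carrier
    A = proj₁ (bounded (f z))
    B = proj₁ (bounded (g z))
    K = A + B + 1#
    A-bound : Within A (f z)
    A-bound = proj₂ (bounded (f z))
    B-bound : Within B (g z)
    B-bound = proj₂ (bounded (g z))
    0≺K : 0# ≺ K
    0≺K = +-posʳ (+-nonneg (within⇒0≤ A-bound) (within⇒0≤ B-bound)) 0≺1
    small : ∃ λ ρ → 0# ≺ ρ × ρ ≤ 1# × ρ ≤ ε * recip K
    small = pos-min 0≺1 (*-pos 0≺ε (recip-pos 0≺K))
    ρ : Carrier
    ρ = proj₁ small
    0≺ρ : 0# ≺ ρ
    0≺ρ = proj₁ (proj₂ small)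
    ρ-bound : ρ * ρ + (A * ρ + ρ * B) ≤ ε
    ρ-bound = ≤-trans
      (0≤⇒≤ (*-nonneg (≺⇒≤ 0≺ρ) (≤⇒0≤ (proj₁ (proj₂ (proj₂ small)))))
        (solve 3 (λ a b x → x :* (con (+ 1) :- x) := (a :+ b :+ con (+ 1)) :* x :- (x :* x :+ (a :* x :+ x :* b)))
          refl A B ρ))
      (scale 0≺K (proj₂ (proj₂ (proj₂ small))))

  recip-antitone : ∀ {x y} → 0# ≺ x → x ≤ y → recip y ≤ recip x
  recip-antitone {x} {y} 0≺x x≤y =
    0≤⇒≤ (*-nonneg (*-nonneg (≤⇒0≤ x≤y) (recip-nonneg 0≺x)) (recip-nonneg 0≺y))
      (trans (solve 4 (λ x y r s → (y :- x) :* r :* s := (y :* s) :* r :- (x :* r) :* s) refl x y (recip x) (recip y))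
        (+-cong (trans (*-congʳ (*-recip 0≺y)) (*-identityˡ _))
          (-‿cong (trans (*-congʳ (*-recip 0≺x)) (*-identityˡ _)))))
    where
    0≺y : 0# ≺ y
    0≺y = ≺-≤-trans 0≺x x≤y

  -- With a = f z and h = a/2, a deviation ρ ≤ h keeps b = f z′ at least h, so that 1/a - 1/b = (b -
  -- a)/(ab) is bounded by `ρ * K`.
  continuous-recip : ∀ {z : Point d} {f} → 0# ≺ f z → ContinuousAt z f → ContinuousAt z (λ s → recip (f s))
  continuous-recip {z = z} {f} 0≺a F ε 0≺ε = eventually-map bound (F ρ 0≺ρ)
    where
    a h K : Carrier
    a = f z
    h = proj₁ (halve 0≺a)
    K = recip h * recip a
    0≺h : 0# ≺ h
    0≺h = proj₁ (proj₂ (halve 0≺a))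
    0≺K : 0# ≺ K
    0≺K = *-pos (recip-pos 0≺h) (recip-pos 0≺a)
    small : ∃ λ ρ → 0# ≺ ρ × ρ ≤ h × ρ ≤ ε * recip K
    small = pos-min 0≺h (*-pos 0≺ε (recip-pos 0≺K))
    ρ : Carrier
    ρ = proj₁ small
    0≺ρ : 0# ≺ ρ
    0≺ρ = proj₁ (proj₂ small)
    bound : (λ z′ → Within ρ (f z′ - a)) ⊆ (λ z′ → Within ε (recip (f z′) - recip a))
    bound {z′} p = within-weaken
      (≤-respˡ-≈ (*-comm K ρ) (scale 0≺K (proj₂ (proj₂ (proj₂ small)))))
      (within-resp
        (trans (solve 4 (λ a b r s → :- (b :- a) :* (s :* r) := (a :* r) :* s :- (b :* s) :* r) refl a b (recip a) (recip b))
          (+-cong (trans (*-congʳ (*-recip 0≺a)) (*-identityˡ _))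
            (-‿cong (trans (*-congʳ (*-recip 0≺b)) (*-identityˡ _)))))
        (within-* (within-neg p)
          (within-* (0≤-within (recip-nonneg 0≺b) (recip-antitone 0≺h h≤b))
                    (0≤-within (recip-nonneg 0≺a) ≤-refl))))
      where
      b : Carrier
      b = f z′
      h≤b : h ≤ b
      h≤b = 0≤⇒≤ (+-nonneg (≤⇒0≤ (proj₁ p)) (≤⇒0≤ (proj₁ (proj₂ (proj₂ small)))))
        (trans (solve 4 (λ a b d h → (b :- a :- :- d) :+ (h :- d) := b :- a :+ h) refl a b ρ h)
          (trans (+-congʳ (+-congˡ (-‿cong (sym (proj₂ (proj₂ (halve 0≺a)))))))
            (solve 2 (λ b h → b :- (h :+ h) :+ h := b :- h) refl b h)))
      0≺b : 0# ≺ b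
      0≺b = ≺-≤-trans 0≺h h≤b
      0≤-within : ∀ {x y} → 0# ≤ x → x ≤ y → Within y x
      0≤-within 0≤x x≤y = ≤-trans (proj₁ (within-0 (≤-trans 0≤x x≤y))) 0≤x , x≤y

  -- Maxima, truncation and sign preservation

  x≤x⊔y : ∀ x y → x ≤ x ⊔ y
  x≤x⊔y x y with total x y
  ... | inj₁ x≤y = x≤y
  ... | inj₂ _ = ≤-refl

  y≤x⊔y : ∀ x y → y ≤ x ⊔ y
  y≤x⊔y x y with total x y
  ... | inj₁ _ = ≤-refl
  ... | inj₂ y≤x = y≤x

  ⊔-lub : ∀ {x y z} → x ≤ z → y ≤ z → x ⊔ y ≤ z
  ⊔-lub {x} {y} x≤z y≤z with total x y
  ... | inj₁ _ = y≤z
  ... | inj₂ _ = x≤z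

  within-0⊔ : ∀ {ε x y} → Within ε (x - y) → Within ε ((0# ⊔ x) - (0# ⊔ y))
  within-0⊔ {ε} {x} {y} (p , q) with within⇒0≤ (p , q) | total 0# x | total 0# y
  ... | 0≤ε | inj₁ 0≤x | inj₁ 0≤y = p , q
  ... | 0≤ε | inj₁ 0≤x | inj₂ y≤0 =
    0≤⇒≤ (+-nonneg 0≤x 0≤ε) (solve 2 (λ x e → x :+ e := x :- con (+ 0) :- :- e) refl x ε) ,
    0≤⇒≤ (+-nonneg (≤⇒0≤ q) (≤⇒0≤ y≤0))
      (solve 3 (λ e x y → (e :- (x :- y)) :+ (con (+ 0) :- y) := e :- (x :- con (+ 0))) refl ε x y)
  ... | 0≤ε | inj₂ x≤0 | inj₁ 0≤y =
    0≤⇒≤ (+-nonneg (≤⇒0≤ p) (≤⇒0≤ x≤0))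
      (solve 3 (λ e x y → (x :- y :- :- e) :+ (con (+ 0) :- x) := con (+ 0) :- y :- :- e) refl ε x y) ,
    0≤⇒≤ (+-nonneg 0≤y 0≤ε) (solve 2 (λ y e → y :+ e := e :- (con (+ 0) :- y)) refl y ε)
  ... | 0≤ε | inj₂ x≤0 | inj₂ y≤0 = within-resp (sym (-‿inverseʳ 0#)) (within-0 0≤ε)

  continuous-0⊔ : ∀ {z : Point d} {f} → ContinuousAt z f → ContinuousAt z (λ s → 0# ⊔ f s)
  continuous-0⊔ F ε 0≺ε = eventually-map within-0⊔ (F ε 0≺ε)

  continuous-sum : ∀ {n} {z : Point d} {f : Fin n → Point d → Carrier} →
    (∀ i → ContinuousAt z (f i)) → ContinuousAt z (λ s → sum (λ i → f i s))
  continuous-sum {n = zero} F = continuous-const 0#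
  continuous-sum {n = suc n} F = continuous-+ (F zero) (continuous-sum (F ∘ suc))

  continuous⇒≺ : ∀ {z : Point d} {f b} → ContinuousAt z f → f z ≺ b → Eventually z (λ z′ → f z′ ≺ b)
  continuous⇒≺ {z = z} {f} {b} F fz≺b with η , 0≺η , η+η≈ ← halve (≺⇒0≺ fz≺b) =
    eventually-map (λ {z′} p → 0≺⇒≺ (+-posˡ 0≺η (≤⇒0≤ (proj₂ p)))
      (trans (solve 3 (λ h f′ f → h :+ (h :- (f′ :- f)) := (h :+ h) :+ f :- f′) refl η (f z′) (f z))
        (trans (+-congʳ (+-congʳ η+η≈)) (solve 3 (λ b f f′ → b :- f :+ f :- f′ := b :- f′) refl b (f z) (f z′)))))
      (F η 0≺η)

  -- The minimum of L and x, in a form to which within-0⊔ applies.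
  clamp : Carrier → Carrier → Carrier
  clamp L x = L - (0# ⊔ (L - x))

  clamp-lipschitz : ∀ {L ε x y} → Within ε (x - y) → Within ε (clamp L x - clamp L y)
  clamp-lipschitz {L} {ε} {x} {y} p = within-resp
    (solve 3 (λ l a b → :- (a :- b) := (l :- a) :- (l :- b)) refl L (0# ⊔ (L - x)) (0# ⊔ (L - y)))
    (within-neg (within-0⊔ (within-resp (solve 3 (λ l x y → :- (x :- y) := (l :- x) :- (l :- y)) refl L x y) (within-neg p))))

  clamp-≥ : ∀ {L x} → L ≤ x → clamp L x ≈ L
  clamp-≥ {L} {x} L≤x = trans (+-congˡ (-‿cong (≤-antisym (⊔-lub ≤-refl L-x≤0) (x≤x⊔y 0# _))))
    (solve 1 (λ l → l :- con (+ 0) := l) refl L)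
    where
    L-x≤0 : L - x ≤ 0#
    L-x≤0 = 0≤⇒≤ (≤⇒0≤ L≤x) (solve 2 (λ l x → x :- l := con (+ 0) :- (l :- x)) refl L x)

  clamp-≤ : ∀ {L x} → x ≤ L → clamp L x ≈ x
  clamp-≤ {L} {x} x≤L = trans (+-congˡ (-‿cong (≤-antisym (⊔-lub (≤⇒0≤ x≤L) ≤-refl) (y≤x⊔y 0# _))))
    (solve 2 (λ l x → l :- (l :- x) := x) refl L x)

  clamp-within : ∀ {L x} → 0# ≤ L → - L ≤ x → Within L (clamp L x)
  clamp-within {L} {x} 0≤L -L≤x =
    0≤⇒≤ (≤⇒0≤ (⊔-lub (+-nonneg 0≤L 0≤L)
        (0≤⇒≤ (≤⇒0≤ -L≤x) (solve 2 (λ l x → x :- :- l := l :+ l :- (l :- x)) refl L x))))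
      (solve 2 (λ l m → l :+ l :- m := l :- m :- :- l) refl L (0# ⊔ (L - x))) ,
    0≤⇒≤ (x≤x⊔y 0# (L - x)) (solve 2 (λ l m → m := l :- (l :- m)) refl L (0# ⊔ (L - x)))

  ·-nonneg : ∀ {ε} → 0# ≤ ε → ∀ n → 0# ≤ n · ε
  ·-nonneg 0≤ε zero = ≤-refl
  ·-nonneg 0≤ε (suc n) = +-nonneg 0≤ε (·-nonneg 0≤ε n)

  continuous⇒≻ : ∀ {d} {z : Point d} {f} → ContinuousAt z f → 0# ≺ f z → Eventually z (λ z′ → 0# ≺ f z′)
  continuous⇒≻ {f = f} F 0≺fz = eventually-map
    (λ {z′} p → 0≺⇒≺ (≺⇒0≺ p) (solve 1 (λ a → con (+ 0) :- :- a := a :- con (+ 0)) refl (f z′)))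
    (continuous⇒≺ (continuous-neg F) (0≺⇒≺ 0≺fz (solve 1 (λ a → a := con (+ 0) :- :- a) refl _)))

  ≉⇒≺⊎≻ : ∀ {x} → ¬ (x ≈ 0#) → 0# ≺ x ⊎ x ≺ 0#
  ≉⇒≺⊎≻ {x} x≉0 with ≤-or-≻ x 0# | ≤-or-≻ 0# x
  ... | inj₂ p | _ = inj₁ p
  ... | inj₁ p | inj₂ q = inj₂ q
  ... | inj₁ p | inj₁ q = ⊥-elim (x≉0 (≤-antisym p q))

  -- The Poincaré-Miranda theorem

  module _ {d : ℕ} {L : Carrier} (0≤L : 0# ≤ L) (G : Point d → Point d)
    (continuous : ∀ z → Box L z → ∀ k → ContinuousAt z (λ s → G s k))
    (low  : ∀ z → Box L z → ∀ k → z k ≈ - L → G z k ≤ 0#)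
    (high : ∀ z → Box L z → ∀ k → z k ≈ L → 0# ≺ G z k) where

    private
      SignDefinite : Carrier → Point d → Set
      SignDefinite ε z = ∃ λ k → Near ε z ⊆ (λ s → 0# ≺ G s k) ⊎ Near ε z ⊆ (λ s → G s k ≺ 0#)

      -- `ε` acts as a Lebesgue number: one scale for all points of `U`, and hence a usable mesh for
      -- the grid.
      Uniform : Pred (Point d) 0ℓ → Set
      Uniform U = ∃ λ ε → 0# ≺ ε × (∀ z → U z → SignDefinite ε z)

      shrink : ∀ {ε η z} → ε ≤ η → SignDefinite η z → SignDefinite ε z
      shrink ε≤η (k , inj₁ p) = k , inj₁ λ n → p (λ i → within-weaken ε≤η (n i))
      shrink ε≤η (k , inj₂ p) = k , inj₂ λ n → p (λ i → within-weaken ε≤η (n i))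

      near-trans : ∀ {ε η} {z z′ z″ : Point d} → ε + ε ≈ η → Near ε z z′ → Near ε z′ z″ → Near η z z″
      near-trans e p q k = within-weaken (≤-reflexive e)
        (within-resp (solve 3 (λ a b c → (b :- a) :+ (c :- b) := c :- a) refl _ _ _) (within-+ (p k) (q k)))

      -- Half the radius serves all points within half the radius, with the same coordinate and
      -- sign.
      uniform-near : ∀ {z} → (∃ λ η → 0# ≺ η × SignDefinite η z) → ∃ λ η → 0# ≺ η × Uniform (Near η z)
      uniform-near (η , 0≺η , k , sign) with halve 0≺η
      ... | ε , 0≺ε , e = ε , 0≺ε , ε , 0≺ε , λ z′ n → k , transport sign n
        where
        transport : ∀ {z z′} → Near η z ⊆ (λ s → 0# ≺ G s k) ⊎ Near η z ⊆ (λ s → G s k ≺ 0#) → Near ε z z′ →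
          Near ε z′ ⊆ (λ s → 0# ≺ G s k) ⊎ Near ε z′ ⊆ (λ s → G s k ≺ 0#)
        transport (inj₁ p) n = inj₁ λ m → p (near-trans e n m)
        transport (inj₂ p) n = inj₂ λ m → p (near-trans e n m)

      nonzero⇒signDefinite : ∀ z → Box L z → ¬ (∀ k → G z k ≈ 0#) → ∃ λ η → 0# ≺ η × SignDefinite η z
      nonzero⇒signDefinite z z∈ nonzero with em₀ (∃ λ k → ¬ (G z k ≈ 0#))
      ... | no none = ⊥-elim (nonzero λ k → decide k (em₀ (G z k ≈ 0#)))
        where
        decide : ∀ k → Dec (G z k ≈ 0#) → G z k ≈ 0#
        decide k (yes p) = p
        decide k (no ¬p) = ⊥-elim (none (k , ¬p))
      ... | yes (k , G≉0) =
        [ (λ p → from₁ (continuous⇒≻ (continuous z z∈ k) p)) , (λ p → from₂ (continuous⇒≺ (continuous z z∈ k) p)) ]′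
        (≉⇒≺⊎≻ G≉0)
        where
        from₁ : Eventually z (λ s → 0# ≺ G s k) → ∃ λ η → 0# ≺ η × SignDefinite η z
        from₁ (η , 0≺η , q) = η , 0≺η , k , inj₁ q
        from₂ : Eventually z (λ s → G s k ≺ 0#) → ∃ λ η → 0# ≺ η × SignDefinite η z
        from₂ (η , 0≺η , q) = η , 0≺η , k , inj₂ q

      not-uniform : ¬ Uniform (Box L)
      not-uniform (ε , 0≺ε , definite) = Cochains.Cube.miranda N a
        (record { low = a-low ; high = a-high }) constant
        where
        fine : ∃ λ N → L + L ≤ N · ε
        fine = archimedean 0≺ε (L + L)

        N : ℕ
        N = proj₁ fine

        -- `N · ε` may overshoot 2L; clamping puts mark `N` exactly on the facet and keeps marks
        -- beyond `N` inside the box.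
        mark : ℕ → Carrier
        mark j = clamp L (- L + j · ε)

        grid : Vec ℕ d → Point d
        grid u i = mark (lookup u i)

        grid-∈ : ∀ u → Box L (grid u)
        grid-∈ u i = clamp-within 0≤L (0≤⇒≤ (·-nonneg (≺⇒≤ 0≺ε) (lookup u i))
          (solve 2 (λ l x → x := :- l :+ x :- :- l) refl L (lookup u i · ε)))

        mark-0 : mark 0 ≈ - L
        mark-0 = trans (clamp-≤ (0≤⇒≤ (+-nonneg 0≤L 0≤L)
          (solve 1 (λ l → l :+ l := l :- (:- l :+ con (+ 0))) refl L))) (+-identityʳ (- L))

        mark-N : mark N ≈ L
        mark-N = clamp-≥ (0≤⇒≤ (≤⇒0≤ (proj₂ fine))
          (solve 2 (λ l x → x :- (l :+ l) := :- l :+ x :- l) refl L (N · ε)))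

        mark-near : ∀ i j → i ≡ j ⊎ i ≡ suc j → Within ε (mark i - mark j)
        mark-near i .i (inj₁ ≡.refl) = within-resp (sym (-‿inverseʳ (mark i))) (within-0 (≺⇒≤ 0≺ε))
        mark-near .(suc j) j (inj₂ ≡.refl) = clamp-lipschitz (within-resp
          (solve 3 (λ l e x → e := (:- l :+ (e :+ x)) :- (:- l :+ x)) refl L ε (j · ε))
          (≤-trans (proj₁ (within-0 (≺⇒≤ 0≺ε))) (≺⇒≤ 0≺ε) , ≤-refl))

        -- Marking strict positivity is why `low` is a weak inequality and `high` a strict one.
        a : Fin d → Vec ℕ d → Bool
        a k u = does (em₀ (0# ≺ G (grid u) k))

        a-low : ∀ k u → lookup u k ≡ 0 → a k u ≡ false
        a-low k u u≡0 = dec-false (em₀ _) λ p →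
          p (low (grid u) (grid-∈ u) k (trans (reflexive (≡.cong mark u≡0)) mark-0))

        a-high : ∀ k u → lookup u k ≡ N → a k u ≡ true
        a-high k u u≡N = dec-true (em₀ _)
          (high (grid u) (grid-∈ u) k (trans (reflexive (≡.cong mark u≡N)) mark-N))

        constant : ∀ v → ∃ λ k → ∃ λ b →
          ∀ u → (∀ i → lookup u i ≡ lookup v i ⊎ lookup u i ≡ suc (lookup v i)) → a k u ≡ b
        constant v = from (definite (grid v) (grid-∈ v))
          where
          from : SignDefinite ε (grid v) → ∃ λ k → ∃ λ b →
            ∀ u → (∀ i → lookup u i ≡ lookup v i ⊎ lookup u i ≡ suc (lookup v i)) → a k u ≡ b
          from (k , inj₁ p) = k , true , λ u u∈ →
            dec-true (em₀ _) (p (λ i → mark-near (lookup u i) (lookup v i) (u∈ i)))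
          from (k , inj₂ p) = k , false , λ u u∈ →
            dec-false (em₀ _) (λ q → p (λ i → mark-near (lookup u i) (lookup v i) (u∈ i)) (≺⇒≤ q))

    abstract
      poincaré-miranda : ∃ λ z → Box L z × (∀ k → G z k ≈ 0#)
      poincaré-miranda with em₀ (∃ λ z → Box L z × (∀ k → G z k ≈ 0#))
      ... | yes p = p
      ... | no ¬p = ⊥-elim (not-uniform (compact Uniform
        (λ { U⊆V (ε , 0≺ε , p) → ε , 0≺ε , λ z z∈ → p z (U⊆V z∈) })
        union 0≤L (λ z z∈ → uniform-near (nonzero⇒signDefinite z z∈ (λ zero-at → ¬p (z , z∈ , zero-at))))))
        where
        union : ∀ {U V} → Uniform U → Uniform V → Uniform (U ∪ V)
        union (ε , 0≺ε , p) (η , 0≺η , q) with ζ , 0≺ζ , ζ≤ε , ζ≤η ← pos-min 0≺ε 0≺η =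
          ζ , 0≺ζ , λ { z (inj₁ z∈) → shrink ζ≤ε (p z z∈) ; z (inj₂ z∈) → shrink ζ≤η (q z z∈) }

  -- Squared lengths and linear functionals

  sq : Point d → Carrier
  sq x = sum (λ k → x k * x k)

  dot : Point d → Point d → Carrier
  dot a x = sum (λ k → a k * x k)

  sq-nonneg : (x : Point d) → 0# ≤ sq x
  sq-nonneg {zero} x = ≤-refl
  sq-nonneg {suc d} x = +-nonneg (square-nonneg (x zero)) (sq-nonneg (x ∘ suc))

  sq-0 : (x : Point d) → (∀ k → x k ≈ 0#) → sq x ≈ 0#
  sq-0 {zero} x x≈0 = refl
  sq-0 {suc d} x x≈0 = trans (+-cong (trans (*-congʳ (x≈0 zero)) (zeroˡ (x zero))) (sq-0 (x ∘ suc) (x≈0 ∘ suc)))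
    (+-identityˡ 0#)

  sq-neg : {x y : Point d} → (∀ k → x k ≈ - y k) → sq x ≈ sq y
  sq-neg {x = x} {y} x≋-y = sum-cong-≋ (λ k → trans (*-cong (x≋-y k) (x≋-y k))
    (solve 1 (λ a → :- a :* :- a := a :* a) refl (y k)))

  coordinate≤sq : (x : Point d) (k : Fin d) → x k * x k ≤ sq x
  coordinate≤sq x zero = 0≤⇒≤ (sq-nonneg (x ∘ suc)) (solve 2 (λ a s → s := a :+ s :- a) refl _ _)
  coordinate≤sq x (suc k) = ≤-trans (coordinate≤sq (x ∘ suc) k)
    (0≤⇒≤ (square-nonneg (x zero)) (solve 2 (λ a s → a := a :+ s :- s) refl _ _))

  sq≤1⇒within : (x : Point d) → sq x ≤ 1# → ∀ k → Within 1# (x k)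
  sq≤1⇒within x sq≤1 k =
    0≤⇒≤ (≤⇒0≤ (square-cancel-≤ 0≤1 (≤-respˡ-≈ (solve 1 (λ a → a :* a := :- a :* :- a) refl (x k)) bound)))
      (solve 1 (λ a → con (+ 1) :- :- a := a :- :- con (+ 1)) refl (x k)) ,
    square-cancel-≤ 0≤1 bound
    where
    bound : x k * x k ≤ 1# * 1#
    bound = ≤-respʳ-≈ (sym (*-identityˡ 1#)) (≤-trans (coordinate≤sq x k) sq≤1)

  sq-affine : (z c x : Point d) →
    sq (z ⊖ x) - sq (c ⊖ x) ≈ sq z - sq c + dot (λ k → 2# * (c k - z k)) x
  sq-affine {zero} z c x = solve 0 (con (+ 0) :- con (+ 0) := con (+ 0) :- con (+ 0) :+ con (+ 0)) refl
  sq-affine {suc d} z c x = trans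
    (solve 5 (λ z c x s t → ((z :- x) :* (z :- x) :+ s) :- ((c :- x) :* (c :- x) :+ t)
        := (z :* z :- c :* c :+ con (+ 2) :* (c :- z) :* x) :+ (s :- t)) refl
      (z zero) (c zero) (x zero) _ _)
    (trans (+-congˡ (sq-affine (z ∘ suc) (c ∘ suc) (x ∘ suc)))
      (solve 6 (λ z c x s t u → (z :* z :- c :* c :+ con (+ 2) :* (c :- z) :* x) :+ (s :- t :+ u)
          := (z :* z :+ s) :- (c :* c :+ t) :+ (con (+ 2) :* (c :- z) :* x :+ u)) refl
        (z zero) (c zero) (x zero) _ _ _))

  dot-linear : (a x y : Point d) (w : Carrier) → dot a (λ k → w * x k + y k) ≈ w * dot a x + dot a y
  dot-linear {zero} a x y w = solve 1 (λ w → con (+ 0) := w :* con (+ 0) :+ con (+ 0)) refl w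
  dot-linear {suc d} a x y w = trans (+-congˡ (dot-linear (a ∘ suc) (x ∘ suc) (y ∘ suc) w))
    (solve 6 (λ a x y w s t → a :* (w :* x :+ y) :+ (w :* s :+ t) := w :* (a :* x :+ s) :+ (a :* y :+ t)) refl
      (a zero) (x zero) (y zero) w _ _)

  dot-scale : (a x : Point d) (w : Carrier) → dot a (λ k → x k * w) ≈ dot a x * w
  dot-scale {zero} a x w = solve 1 (λ w → con (+ 0) := con (+ 0) :* w) refl w
  dot-scale {suc d} a x w = trans (+-congˡ (dot-scale (a ∘ suc) (x ∘ suc) w))
    (solve 4 (λ a x w s → a :* (x :* w) :+ s :* w := (a :* x :+ s) :* w) refl (a zero) (x zero) w _)

  dot-0 : (a : Point d) → dot a origin ≈ 0#
  dot-0 {zero} a = refl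
  dot-0 {suc d} a = trans (+-cong (zeroʳ (a zero)) (dot-0 (a ∘ suc))) (+-identityˡ 0#)

  -- Finite covers by unit balls

  dense-point : (X : Subset d) → OneDense X → ∀ y → ∃ λ x → x ∈ˢ X × sq (y ⊖ x) ≺ 1#
  dense-point X dense y with r , isDist , r≤1 , r≉1 ← dense y =
    from (infimum-≺ _ isDist (λ 1≤r → r≉1 (≤-antisym r≤1 1≤r)))
    where
    from : (∃ λ v → (∃ λ x → x ∈ˢ X × v ≈ ‖ y ⊖ x ‖) × v ≺ 1#) → ∃ λ x → x ∈ˢ X × sq (y ⊖ x) ≺ 1#
    from (v , (x , x∈X , v≈) , v≺1) = x , x∈X , λ 1≤sq → v≺1 (≤-respʳ-≈ (sym v≈) (1≤⇒1≤√ 1≤sq))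

  Covers : List (Point d) → Pred (Point d) 0ℓ → Set
  Covers xs U = ∀ c → U c → Any (λ x → sq (c ⊖ x) ≺ 1#) xs

  continuous-sq : {z : Point d} {f g : Point d → Point d} →
    (∀ k → ContinuousAt z (λ s → f s k)) → (∀ k → ContinuousAt z (λ s → g s k)) →
    ContinuousAt z (λ s → sq (f s ⊖ g s))
  continuous-sq F G = continuous-sum λ k → continuous-* (diff k) (diff k)
    where
    diff : ∀ k → ContinuousAt _ _
    diff k = continuous-+ (F k) (continuous-neg (G k))

  abstract
    -- The unit ball is open, so a point of `X` serving the centre `z` also serves all centres near
    -- `z`; compactness leaves finitely many points.
    finite-cover : (X : Subset d) → OneDense X → ∀ {R} → 0# ≤ R →
      ∃ λ xs → All (_∈ˢ X) xs × Covers xs (Box R)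
    finite-cover {d} X dense 0≤R = compact (λ U → ∃ λ xs → All (_∈ˢ X) xs × Covers xs U)
      (λ { U⊆V (xs , xs∈X , cover) → xs , xs∈X , λ c c∈U → cover c (U⊆V c∈U) })
      (λ { (xs , xs∈X , cover) (ys , ys∈X , cover′) → xs ++ ys , All.++⁺ xs∈X ys∈X ,
           λ { c (inj₁ c∈U) → Any.++⁺ˡ (cover c c∈U) ; c (inj₂ c∈V) → Any.++⁺ʳ xs (cover′ c c∈V) } })
      0≤R
      (λ z _ → local (dense-point X dense z))
      where
      local : ∀ {z} → (∃ λ x → x ∈ˢ X × sq (z ⊖ x) ≺ 1#) →
        ∃ λ η → 0# ≺ η × (∃ λ xs → All (_∈ˢ X) xs × Covers xs (Near η z))
      local {z} (x , x∈X , z-x≺1) = from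
        (continuous⇒≺ (continuous-sq {f = λ s → s} {g = λ _ → x} continuous-coordinate (λ k → continuous-const (x k))) z-x≺1)
        where
        from : Eventually z (λ c → sq (c ⊖ x) ≺ 1#) →
          ∃ λ η → 0# ≺ η × (∃ λ xs → All (_∈ˢ X) xs × Covers xs (Near η z))
        from (η , 0≺η , near) = η , 0≺η , x ∷ [] , x∈X ∷ [] , λ c c∈ → here (near c∈)

  -- Weighted means

  -- An unnormalised partition of unity: continuous in `c`, and positive exactly when `x` is in the
  -- open unit ball about `c`.
  weight : Point d → Point d → Carrier
  weight c x = 0# ⊔ (1# - sq (c ⊖ x))

  weight-pos⇒ : (c x : Point d) → 0# ≺ weight c x → sq (c ⊖ x) ≺ 1#
  weight-pos⇒ c x 0≺w 1≤sq = 0≺w (⊔-lub ≤-refl (0≤⇒≤ (≤⇒0≤ 1≤sq)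
    (solve 1 (λ s → s :- con (+ 1) := con (+ 0) :- (con (+ 1) :- s)) refl (sq (c ⊖ x)))))

  ⇒weight-pos : (c x : Point d) → sq (c ⊖ x) ≺ 1# → 0# ≺ weight c x
  ⇒weight-pos c x sq≺1 = ≺-≤-trans (≺⇒0≺ sq≺1) (y≤x⊔y 0# _)

  weightedSum : (Point d → Carrier) → List (Point d) → Point d → Carrier
  weightedSum φ [] c = 0#
  weightedSum φ (x ∷ xs) c = weight c x * φ x + weightedSum φ xs c

  totalWeight : List (Point d) → Point d → Carrier
  totalWeight = weightedSum (λ _ → 1#)

  mean : List (Point d) → Point d → Point d
  mean xs c k = weightedSum (λ x → x k) xs c * recip (totalWeight xs c)

  private
    term-nonneg : ∀ {w u} → 0# ≤ w → (0# ≺ w → 0# ≺ u) → 0# ≤ w * u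
    term-nonneg {w} {u} 0≤w p with ≤-or-≻ w 0#
    ... | inj₁ w≤0 = ≤-reflexive (trans (sym (zeroˡ u)) (*-congʳ (≤-antisym 0≤w w≤0)))
    ... | inj₂ 0≺w = *-nonneg 0≤w (≺⇒≤ (p 0≺w))

  weightedSum-nonneg : ∀ {φ c} (xs : List (Point d)) →
    All (λ x → 0# ≺ weight c x → 0# ≺ φ x) xs → 0# ≤ weightedSum φ xs c
  weightedSum-nonneg [] [] = ≤-refl
  weightedSum-nonneg (x ∷ xs) (p ∷ ps) = +-nonneg (term-nonneg (x≤x⊔y 0# _) p) (weightedSum-nonneg xs ps)

  weightedSum-pos : ∀ {φ c} (xs : List (Point d)) → Any (λ x → 0# ≺ weight c x) xs →
    All (λ x → 0# ≺ weight c x → 0# ≺ φ x) xs → 0# ≺ weightedSum φ xs c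
  weightedSum-pos (x ∷ xs) (here 0≺w) (p ∷ ps) = +-posˡ (*-pos 0≺w (p 0≺w)) (weightedSum-nonneg xs ps)
  weightedSum-pos (x ∷ xs) (there q) (p ∷ ps) = +-posʳ (term-nonneg (x≤x⊔y 0# _) p) (weightedSum-pos xs q ps)

  weightedSum-shift : ∀ φ b (xs : List (Point d)) c →
    weightedSum (λ x → φ x - b) xs c ≈ weightedSum φ xs c - totalWeight xs c * b
  weightedSum-shift φ b [] c = solve 1 (λ b → con (+ 0) := con (+ 0) :- con (+ 0) :* b) refl b
  weightedSum-shift φ b (x ∷ xs) c = trans (+-congˡ (weightedSum-shift φ b xs c))
    (solve 5 (λ w f b s t → w :* (f :- b) :+ (s :- t :* b) := (w :* f :+ s) :- (w :* con (+ 1) :+ t) :* b) refl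
      (weight c x) (φ x) b _ _)

  weightedSum-neg : ∀ φ (xs : List (Point d)) c → weightedSum (λ x → - φ x) xs c ≈ - weightedSum φ xs c
  weightedSum-neg φ [] c = solve 0 (con (+ 0) := :- con (+ 0)) refl
  weightedSum-neg φ (x ∷ xs) c = trans (+-congˡ (weightedSum-neg φ xs c))
    (solve 3 (λ w f s → w :* :- f :+ :- s := :- (w :* f :+ s)) refl (weight c x) (φ x) _)

  weightedSum-dot : ∀ (a : Point d) xs c →
    dot a (λ k → weightedSum (λ x → x k) xs c) ≈ weightedSum (dot a) xs c
  weightedSum-dot a [] c = dot-0 a
  weightedSum-dot a (x ∷ xs) c = trans
    (dot-linear a x (λ k → weightedSum (λ y → y k) xs c) (weight c x)) (+-congˡ (weightedSum-dot a xs c))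

  module _ {xs : List (Point d)} {c : Point d} (near : Any (λ x → sq (c ⊖ x) ≺ 1#) xs) where

    totalWeight-pos : 0# ≺ totalWeight xs c
    totalWeight-pos = weightedSum-pos xs (Any.map (λ {x} → ⇒weight-pos c x) near) (All.universal (λ _ _ → 0≺1) xs)

    -- If `φ` exceeded `b` at every point of positive weight, the weighted sum of φ - b would be
    -- positive, whereas it is zero.
    below-mean : ∀ φ b → weightedSum φ xs c ≈ totalWeight xs c * b →
      Any (λ x → sq (c ⊖ x) ≺ 1# × φ x ≤ b) xs
    below-mean φ b mean≈ with em₀ (Any (λ x → sq (c ⊖ x) ≺ 1# × φ x ≤ b) xs)
    ... | yes p = p
    ... | no ¬p = ⊥-elim (weightedSum-pos xs (Any.map (λ {x} → ⇒weight-pos c x) near)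
      (All.map (λ {x} q 0≺w → ≺⇒0≺ (λ φ≤b → q (weight-pos⇒ c x 0≺w , φ≤b))) (All.¬Any⇒All¬ xs ¬p))
      (≤-reflexive (trans (weightedSum-shift φ b xs c) (trans (+-congʳ mean≈) (-‿inverseʳ _)))))

    private
      W : Carrier
      W = totalWeight xs c

      cancel : ∀ x → x ≈ W * (x * recip W)
      cancel x = sym (trans (solve 3 (λ w x r → w :* (x :* r) := x :* (w :* r)) refl W x (recip W))
        (trans (*-congˡ (*-recip totalWeight-pos)) (*-identityʳ x)))

    mean-dot : ∀ a → weightedSum (dot a) xs c ≈ W * dot a (mean xs c)
    mean-dot a = trans (sym (weightedSum-dot a xs c))
      (trans (cancel _) (*-congˡ (sym (dot-scale a (λ k → weightedSum (λ x → x k) xs c) (recip W)))))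

    -- Applying `below-mean` to the `k`-th coordinate and to its negative produces points of the
    -- ball on either side of the mean.
    mean-near : ∀ k → Within 1# (mean xs c k - c k)
    mean-near k =
      lower-bound (Any.satisfied (below-mean (λ x → x k) (mean xs c k) (cancel _))) ,
      upper-bound (Any.satisfied (below-mean (λ x → - x k) (- mean xs c k)
        (trans (weightedSum-neg (λ x → x k) xs c)
          (trans (-‿cong (cancel _)) (solve 2 (λ w y → :- (w :* y) := w :* :- y) refl W (mean xs c k))))))
      where
      lower-bound : (∃ λ x → sq (c ⊖ x) ≺ 1# × x k ≤ mean xs c k) → - 1# ≤ mean xs c k - c k
      lower-bound (x , sq≺1 , x≤) = 0≤⇒≤
        (+-nonneg (≤⇒0≤ (proj₂ (sq≤1⇒within (c ⊖ x) (≺⇒≤ sq≺1) k))) (≤⇒0≤ x≤))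
        (solve 3 (λ c x y → (con (+ 1) :- (c :- x)) :+ (y :- x) := y :- c :- :- con (+ 1)) refl (c k) (x k) _)
      upper-bound : (∃ λ x → sq (c ⊖ x) ≺ 1# × - x k ≤ - mean xs c k) → mean xs c k - c k ≤ 1#
      upper-bound (x , sq≺1 , x≥) = 0≤⇒≤
        (+-nonneg (≤⇒0≤ (proj₁ (sq≤1⇒within (c ⊖ x) (≺⇒≤ sq≺1) k))) (≤⇒0≤ x≥))
        (solve 3 (λ c x y → (c :- x :- :- con (+ 1)) :+ (:- y :- :- x) := con (+ 1) :- (y :- c)) refl (c k) (x k) _)

    -- Some x has |z − x|² − |c − x|² at most |z − y|² − |c − y|² ≤ 1 for y the mean.
    mean-step : (z : Point d) → sq (z ⊖ mean xs c) ≤ 1# →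
      Any (λ x → sq (c ⊖ x) ≺ 1# × sq (z ⊖ x) ≤ 2#) xs
    mean-step z sq≤1 = Any.map (λ {x} → from x) (below-mean (dot a) (dot a y) (mean-dot a))
      where
      y a : Point d
      y = mean xs c
      a k = 2# * (c k - z k)
      from : ∀ x → sq (c ⊖ x) ≺ 1# × dot a x ≤ dot a y → sq (c ⊖ x) ≺ 1# × sq (z ⊖ x) ≤ 2#
      from x (sq≺1 , dot≤) = sq≺1 , 0≤⇒≤
        (+-nonneg (+-nonneg (≤⇒0≤ dot≤) (sq-nonneg (c ⊖ y))) (+-nonneg (≤⇒0≤ (≺⇒≤ sq≺1)) (≤⇒0≤ sq≤1)))
        -- The first two brackets on the right vanish by `sq-affine` at `y` and at `x`, leaving 2 -
        -- |z - x|².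
        (trans (solve 8 (λ dx dy cy cx zx zy z c →
              (dy :- dx :+ cy) :+ ((con (+ 1) :- cx) :+ (con (+ 1) :- zy)) :=
              (z :- c :+ dy :- (zy :- cy)) :+ ((zx :- cx) :- (z :- c :+ dx)) :+ (con (+ 2) :- zx)) refl
            (dot a x) (dot a y) (sq (c ⊖ y)) (sq (c ⊖ x)) (sq (z ⊖ x)) (sq (z ⊖ y)) (sq z) (sq c))
          (trans (+-congʳ (+-cong
              (trans (+-congʳ (sym (sq-affine z c y))) (-‿inverseʳ _))
              (trans (+-congˡ (-‿cong (sym (sq-affine z c x)))) (-‿inverseʳ _))))
            (solve 1 (λ s → con (+ 0) :+ con (+ 0) :+ s := s) refl _)))

  continuous-weightedSum : ∀ {z : Point d} {f : Point d → Point d} φ xs →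
    (∀ k → ContinuousAt z (λ s → f s k)) → ContinuousAt z (λ s → weightedSum φ xs (f s))
  continuous-weightedSum φ [] F = continuous-const 0#
  continuous-weightedSum φ (x ∷ xs) F = continuous-+
    (continuous-* (continuous-0⊔ (continuous-+ (continuous-const 1#)
        (continuous-neg (continuous-sq F (λ k → continuous-const (x k))))))
      (continuous-const (φ x)))
    (continuous-weightedSum φ xs F)

  continuous-mean : ∀ {z : Point d} {f : Point d → Point d} xs →
    (∀ k → ContinuousAt z (λ s → f s k)) → Any (λ x → sq (f z ⊖ x) ≺ 1#) xs →
    ∀ k → ContinuousAt z (λ s → mean xs (f s) k)
  continuous-mean xs F near k = continuous-* (continuous-weightedSum (λ x → x k) xs F)
    (continuous-recip (totalWeight-pos near) (continuous-weightedSum (λ _ → 1#) xs F))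

  box-bound : (t : Point d) → ∃ λ T → 0# ≤ T × Box T t
  box-bound {zero} t = 0# , ≤-refl , λ ()
  box-bound {suc d} t = from (bounded (t zero)) (box-bound (t ∘ suc))
    where
    from : (∃ λ A → Within A (t zero)) → (∃ λ T → 0# ≤ T × Box T (t ∘ suc)) → ∃ λ T → 0# ≤ T × Box T t
    from (A , wA) (T , 0≤T , wT) = A + T , +-nonneg (within⇒0≤ wA) 0≤T , λ where
      zero    → within-weaken (0≤⇒≤ 0≤T (solve 2 (λ a t → t := a :+ t :- a) refl A T)) wA
      (suc k) → within-weaken (0≤⇒≤ (within⇒0≤ wA) (solve 2 (λ a t → a := a :+ t :- t) refl A T)) (wT k)

  -- The virtual walk

  module Virtual {d : ℕ} (t : Point d) (T : Carrier) (0≤T : 0# ≤ T) (t∈ : Box T t) where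

    -- L ≥ 1 makes the shift by `s` outweigh the averaging on the facets, and the margin L - T = 1
    -- makes the sign on the upper facets strict.
    L : Carrier
    L = T + 1#

    1≤L : 1# ≤ L
    1≤L = 0≤⇒≤ 0≤T (solve 1 (λ t → t := t :+ con (+ 1) :- con (+ 1)) refl T)

    0≤L : 0# ≤ L
    0≤L = ≤-trans 0≤1 1≤L

    -- Each virtual step moves a coordinate by at most `L` through the shift and by at most 1
    -- through the averaging.
    radius : ℕ → Carrier
    radius zero = T
    radius (suc m) = radius m + L + 1#

    radius-nonneg : ∀ m → 0# ≤ radius m
    radius-nonneg zero = 0≤T
    radius-nonneg (suc m) = +-nonneg (+-nonneg (radius-nonneg m) 0≤L) 0≤1

    -- The walk runs from `t` towards the first set, so peeling off `xs zero` leaves the virtual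
    -- position with which the real walk is compared after its next step.
    virtual : ∀ {m} → (Fin m → List (Point d)) → Point d → Point d
    virtual {zero} xs s = t
    virtual {suc m} xs s = mean (xs zero) (virtual (xs ∘ suc) s ⊖ s)

    data Covering : ∀ {m} → (Fin m → List (Point d)) → Set where
      none : {xs : Fin 0 → List (Point d)} → Covering xs
      cons : ∀ {m} {xs : Fin (suc m) → List (Point d)} →
        Covers (xs zero) (Box (radius m + L)) → Covering (xs ∘ suc) → Covering xs

    covering : ∀ {m} (X : Fin m → Subset d) → (∀ i → OneDense (X i)) →
      ∃ λ xs → (∀ i → All (_∈ˢ X i) (xs i)) × Covering xs
    covering {zero} X dense = (λ ()) , (λ ()) , none
    covering {suc m} X dense =
      from (finite-cover (X zero) (dense zero) (+-nonneg (radius-nonneg m) 0≤L)) (covering (X ∘ suc) (dense ∘ suc))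
      where
      from : (∃ λ xs → All (_∈ˢ X zero) xs × Covers xs (Box (radius m + L))) →
        (∃ λ xs → (∀ i → All (_∈ˢ X (suc i)) (xs i)) × Covering xs) →
        ∃ λ xs → (∀ i → All (_∈ˢ X i) (xs i)) × Covering xs
      from (xs , xs∈ , cover) (xss , xss∈ , covers) =
        xs ◂ xss , (λ { zero → xs∈ ; (suc i) → xss∈ i }) , cons cover covers

    module _ {s : Point d} (s∈ : Box L s) where

      -- Mutually recursive with `centre-near`: a bounded position puts the next centre in the
      -- covered box, and a covered centre has its mean within 1, which bounds the next position.
      virtual-∈ : ∀ {m} {xs : Fin m → List (Point d)} → Covering xs → Box (radius m) (virtual xs s)

      centre-near : ∀ {m} {xs : Fin (suc m) → List (Point d)} → Covering xs →
        Any (λ x → sq ((virtual (xs ∘ suc) s ⊖ s) ⊖ x) ≺ 1#) (xs zero)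
      centre-near (cons cover covers) = cover _ λ k →
        within-+ (virtual-∈ covers k) (within-neg (s∈ k))

      virtual-∈ none = t∈
      virtual-∈ cov@(cons cover covers) k = within-resp
        (solve 3 (λ v s m → v :- s :+ (m :- (v :- s)) := m) refl _ _ _)
        (within-+ (within-+ (virtual-∈ covers k) (within-neg (s∈ k))) (mean-near (centre-near cov) k))

      virtual-continuous : ∀ {m} {xs : Fin m → List (Point d)} → Covering xs →
        ∀ k → ContinuousAt s (λ s → virtual xs s k)
      virtual-continuous none k = continuous-const (t k)
      virtual-continuous {xs = xs} cov@(cons cover covers) = continuous-mean (xs zero)
        (λ k → continuous-+ (virtual-continuous covers k) (continuous-neg (continuous-coordinate k)))
        (centre-near cov)

      -- The shift lowers coordinate `k` by L ≥ 1 and the averaging raises it by at most 1, so it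
      -- never climbs above its initial bound `T`.
      virtual-high : ∀ {m} {xs : Fin m → List (Point d)} → Covering xs →
        ∀ k → s k ≈ L → virtual xs s k ≤ T
      virtual-high none k s≈L = proj₂ (t∈ k)
      virtual-high cov@(cons cover covers) k s≈L = 0≤⇒≤
        (+-nonneg (+-nonneg (≤⇒0≤ (virtual-high covers k s≈L)) (≤⇒0≤ (≤-respʳ-≈ (sym s≈L) 1≤L)))
          (≤⇒0≤ (proj₂ (mean-near (centre-near cov) k))))
        (solve 4 (λ T v s m → (T :- v) :+ (s :- con (+ 1)) :+ (con (+ 1) :- (m :- (v :- s))) := T :- m) refl
          T _ (s k) _)

      virtual-low : ∀ {m} {xs : Fin m → List (Point d)} → Covering xs →
        ∀ k → s k ≈ - L → - T ≤ virtual xs s k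
      virtual-low none k s≈-L = proj₁ (t∈ k)
      virtual-low cov@(cons cover covers) k s≈-L = 0≤⇒≤
        (+-nonneg (+-nonneg (≤⇒0≤ (virtual-low covers k s≈-L)) (≤⇒0≤ (≤-respˡ-≈ (sym s≈-L) (neg-mono 1≤L))))
          (≤⇒0≤ (proj₁ (mean-near (centre-near cov) k))))
        (solve 4 (λ T v s m → (v :- :- T) :+ (:- con (+ 1) :- s) :+ (m :- (v :- s) :- :- con (+ 1)) := m :- :- T) refl
          T _ (s k) _)

    closing-step : ∀ {m} {xs : Fin m → List (Point d)} → Covering xs →
      ∃ λ s → Box L s × (∀ k → s k - virtual xs s k ≈ 0#)
    closing-step {xs = xs} cov = poincaré-miranda 0≤L (λ s → s ⊖ virtual xs s)
      (λ s s∈ k → continuous-+ (continuous-coordinate k) (continuous-neg (virtual-continuous s∈ cov k)))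
      (λ s s∈ k s≈-L → 0≤⇒≤
        (+-nonneg (+-nonneg (≤⇒0≤ (virtual-low s∈ cov k s≈-L)) (≤⇒0≤ (≤-reflexive s≈-L))) 0≤1)
        (solve 3 (λ v s T → (v :- :- T) :+ (:- (T :+ con (+ 1)) :- s) :+ con (+ 1) := con (+ 0) :- (s :- v)) refl _ (s k) T))
      (λ s s∈ k s≈L → 0≺⇒≺
        (+-posʳ (+-nonneg (≤⇒0≤ (virtual-high s∈ cov k s≈L)) (≤⇒0≤ (≤-reflexive (sym s≈L)))) 0≺1)
        (solve 3 (λ v s T → (T :- v) :+ (s :- (T :+ con (+ 1))) :+ con (+ 1) := s :- v :- con (+ 0)) refl _ (s k) T))

    -- `start` is a propositional equality, so membership and the step bound are transported to the
    -- first point by `subst`.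
    record Path {m : ℕ} (X : Fin m → Subset d) (s a : Point d) : Set where
      field
        points : Tuple d (suc m)
        start  : points zero ≡ a
        end    : points (fromℕ (suc m)) ≋ t
        member : ∀ i → points (suc (inject₁ i)) ∈ˢ X i
        steps  : ∀ i → sq (step points i ⊖ s) ≤ 2#

    open Path

    -- The invariant says that a + s, the ideal next position, is within 1 of the virtual one. With
    -- c = v - s, the bound |c - x| < 1 rewrites to |x + s - v| < 1, the invariant at `x`.
    path : ∀ {s} → Box L s → ∀ {m} (X : Fin m → Subset d) {xs : Fin m → List (Point d)} →
      (∀ i → All (_∈ˢ X i) (xs i)) → Covering xs → (a : Point d) →
      sq ((λ k → a k + s k) ⊖ virtual xs s) ≤ 1# → Path X s a
    path {s} s∈ X xs∈ none a a-near = record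
      { points = a ◂ t ◂ λ ()
      ; start  = ≡.refl
      ; end    = λ _ → refl
      ; member = λ ()
      -- With no set left the virtual position is `t`, so the invariant itself bounds the last step.
      ; steps  = λ { zero → ≤-trans (≤-respˡ-≈
          (sq-neg (λ k → solve 3 (λ a s t → a :+ s :- t := :- (t :- a :- s)) refl (a k) (s k) (t k))) a-near)
          (0≤⇒≤ 0≤1 (solve 0 (con (+ 1) := con (+ 2) :- con (+ 1)) refl)) }
      }
    path {s} s∈ {suc m} X {xs} xs∈ cov@(cons cover covers) a a-near =
      extend (All.lookupAny (xs∈ zero) next)
      where
      c : Point d
      c = virtual (xs ∘ suc) s ⊖ s

      next : Any (λ x → sq (c ⊖ x) ≺ 1# × sq ((λ k → a k + s k) ⊖ x) ≤ 2#) (xs zero)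
      next = mean-step (centre-near s∈ cov) (λ k → a k + s k) a-near

      x : Point d
      x = Any.lookup next

      extend : x ∈ˢ X zero × (sq (c ⊖ x) ≺ 1# × sq ((λ k → a k + s k) ⊖ x) ≤ 2#) → Path X s a
      extend (x∈X , c-near , step≤2) = record
        { points = a ◂ points rest
        ; start  = ≡.refl
        ; end    = end rest
        ; member = λ { zero → ≡.subst (_∈ˢ X zero) (≡.sym (start rest)) x∈X ; (suc i) → member rest i }
        ; steps  = λ { zero → ≡.subst (λ y → sq ((y ⊖ a) ⊖ s) ≤ 2#) (≡.sym (start rest)) first ; (suc i) → steps rest i }
        }
        where
        rest : Path (X ∘ suc) s x
        rest = path s∈ (X ∘ suc) (xs∈ ∘ suc) covers x (≤-respˡ-≈
          (sq-neg (λ k → solve 3 (λ v s x → v :- s :- x := :- (x :+ s :- v)) refl _ (s k) (x k))) (≺⇒≤ c-near))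
        first : sq ((x ⊖ a) ⊖ s) ≤ 2#
        first = ≤-respˡ-≈
          (sq-neg (λ k → solve 3 (λ a s x → a :+ s :- x := :- (x :- a :- s)) refl (a k) (s k) (x k))) step≤2

  abstract
    almost-equal-steps : ∀ {d m} (t : Point d) (X : Fin m → Subset d) → (∀ i → OneDense (X i)) →
      Σ (Tuple d (suc m)) λ p → Σ (Point d) λ s →
        Admissible t X p × (∀ i → ‖ step p i ⊖ s ‖ ≤ √ 2#)
    almost-equal-steps {d} {m} t X dense = bound (box-bound t)
      where
      bound : (∃ λ T → 0# ≤ T × Box T t) → Σ (Tuple d (suc m)) λ p → Σ (Point d) λ s →
        Admissible t X p × (∀ i → ‖ step p i ⊖ s ‖ ≤ √ 2#)
      bound (T , 0≤T , t∈) = cover (covering X dense)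
        where
        open Virtual t T 0≤T t∈
        open Path
        cover : (∃ λ xs → (∀ i → All (_∈ˢ X i) (xs i)) × Covering xs) →
          Σ (Tuple d (suc m)) λ p → Σ (Point d) λ s →
            Admissible t X p × (∀ i → ‖ step p i ⊖ s ‖ ≤ √ 2#)
        cover (xs , xs∈ , cov) = close (closing-step cov)
          where
          close : (∃ λ s → Box L s × (∀ k → s k - virtual xs s k ≈ 0#)) →
            Σ (Tuple d (suc m)) λ p → Σ (Point d) λ s →
              Admissible t X p × (∀ i → ‖ step p i ⊖ s ‖ ≤ √ 2#)
          close (s , s∈ , s≈) = points walk , s ,
            record { start = λ k → reflexive (≡.cong (λ x → x k) (start walk)) ; end = end walk ; member = member walk } ,
            λ i → √-mono (steps walk i)
            where
            walk : Path X s origin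
            -- At the origin the invariant compares `s` with `virtual xs s`, which coincide by the
            -- choice of `s`.
            walk = path s∈ X xs∈ cov origin (≤-trans (≤-reflexive
              (sq-0 _ λ k → trans (+-congʳ (+-identityˡ (s k))) (s≈ k))) 0≤1)

  -- Finite maxima and the comparison of δ with δ′

  max-nonneg : (x : Vector Carrier n) → 0# ≤ max x
  max-nonneg {zero} x = ≤-refl
  max-nonneg {suc n} x = ≤-trans (max-nonneg (x ∘ suc)) (y≤x⊔y (x zero) _)

  ≤max : (x : Vector Carrier n) (i : Fin n) → x i ≤ max x
  ≤max x zero = x≤x⊔y (x zero) _
  ≤max x (suc i) = ≤-trans (≤max (x ∘ suc) i) (y≤x⊔y (x zero) _)

  max-lub : {x : Vector Carrier n} {b : Carrier} → 0# ≤ b → (∀ i → x i ≤ b) → max x ≤ b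
  max-lub {zero} 0≤b p = 0≤b
  max-lub {suc n} 0≤b p = ⊔-lub (p zero) (max-lub 0≤b (p ∘ suc))

  -- By the parallelogram law the defect is |(a - s) + (b - s)|². When both distances to `s` are at
  -- most `M`, the right side is at most (2M)².
  parallelogram : (a b s : Point d) → sq (a ⊖ b) ≤ 2# * sq (a ⊖ s) + 2# * sq (b ⊖ s)
  parallelogram {zero} a b s = ≤-reflexive (solve 0 (con (+ 0) := con (+ 2) :* con (+ 0) :+ con (+ 2) :* con (+ 0)) refl)
  parallelogram {suc d} a b s = 0≤⇒≤
    (+-nonneg (square-nonneg (a zero - s zero + (b zero - s zero))) (≤⇒0≤ (parallelogram (a ∘ suc) (b ∘ suc) (s ∘ suc))))
    (solve 6 (λ a b s x y z →
      (a :- s :+ (b :- s)) :* (a :- s :+ (b :- s)) :+ (con (+ 2) :* x :+ con (+ 2) :* y :- z) :=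
      con (+ 2) :* ((a :- s) :* (a :- s) :+ x) :+ con (+ 2) :* ((b :- s) :* (b :- s) :+ y) :- ((a :- b) :* (a :- b) :+ z)) refl
      (a zero) (b zero) (s zero) _ _ _)

  ‖⊖‖≤2M : ∀ {M} (a b s : Point d) → 0# ≤ M → ‖ a ⊖ s ‖ ≤ M → ‖ b ⊖ s ‖ ≤ M → ‖ a ⊖ b ‖ ≤ 2# * M
  ‖⊖‖≤2M {M = M} a b s 0≤M p q = ≤²⇒√≤ (*-nonneg (≺⇒≤ 0≺2) 0≤M) (≤-trans (parallelogram a b s)
    (0≤⇒≤ (*-nonneg (≺⇒≤ 0≺2) (+-nonneg (≤⇒0≤ (√≤⇒≤² 0≤M p)) (≤⇒0≤ (√≤⇒≤² 0≤M q))))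
      (solve 3 (λ m x y → con (+ 2) :* ((m :* m :- x) :+ (m :* m :- y)) :=
         con (+ 2) :* m :* (con (+ 2) :* m) :- (con (+ 2) :* x :+ con (+ 2) :* y)) refl M _ _)))

  spread : Tuple d n → Point d → Carrier
  spread p s = max (λ i → ‖ step p i ⊖ s ‖)

  δ≤2spread : (p : Tuple d n) (s : Point d) → δ p ≤ 2# * spread p s
  δ≤2spread {n = n} p s = max-lub {n} 0≤ λ j → max-lub {toℕ j} {λ i → ‖ step p (inject i) ⊖ step p j ‖} 0≤ λ i →
    ‖⊖‖≤2M (step p (inject i)) (step p j) s (max-nonneg dist) (≤max dist (inject i)) (≤max dist j)
    where
    dist : Vector Carrier _
    dist i = ‖ step p i ⊖ s ‖
    0≤ : 0# ≤ 2# * spread p s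
    0≤ = *-nonneg (≺⇒≤ 0≺2) (max-nonneg dist)

  δ≤δ′ : (p : Tuple d n) {v : Carrier} → Isδ′ p v → δ p ≤ v
  δ≤δ′ p (m , ((s , m≈) , _) , v≈) =
    ≤-trans (δ≤2spread p s) (≤-reflexive (trans (*-congˡ (sym m≈)) (sym v≈)))

  δ′-nonneg : (p : Tuple d n) {v : Carrier} → Isδ′ p v → 0# ≤ v
  δ′-nonneg p is = ≤-trans (max-nonneg (λ j → max {toℕ j} λ i → ‖ step p (inject i) ⊖ step p j ‖)) (δ≤δ′ p is)

  -- Attainment of the minimum in δ′

  module _ (p : Tuple d (suc n)) where

    Spreads : Pred Carrier 0ℓ
    Spreads r = Σ (Point d) λ s → r ≈ spread p s

    private
      module _ {M : Carrier} (0≤M : 0# ≤ M) where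

        -- The spread exceeds `M` with a margin measured in squares, where continuity in `s` is that
        -- of a polynomial.
        Far : Carrier → Point d → Set
        Far ε s = ∃ λ i → M * M + ε ≤ sq (step p i ⊖ s)

        FarOn : Pred (Point d) 0ℓ → Set
        FarOn U = ∃ λ ε → 0# ≺ ε × (∀ s → U s → Far ε s)

        far-weaken : ∀ {ε η s} → ε ≤ η → Far η s → Far ε s
        far-weaken ε≤η (i , q) = i , ≤-trans (+-mono-≤ ≤-refl ε≤η) q

        ≻spread⇒far : ∀ s → M ≺ spread p s → ∃ λ i → M * M ≺ sq (step p i ⊖ s)
        ≻spread⇒far s M≺ with em₀ (∃ λ i → M * M ≺ sq (step p i ⊖ s))
        ... | yes q = q
        ... | no ¬q = ⊥-elim (M≺ (max-lub 0≤M λ i → ≤²⇒√≤ 0≤M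
          ([ (λ q → q) , (λ q → ⊥-elim (¬q (i , q))) ]′ (≤-or-≻ _ (M * M)))))

        far-near : ∀ s → (∃ λ i → M * M ≺ sq (step p i ⊖ s)) → ∃ λ η → 0# ≺ η × FarOn (Near η s)
        far-near s (i , M²≺) = from (halve (≺⇒0≺ M²≺))
          where
          from : (∃ λ h → 0# ≺ h × h + h ≈ sq (step p i ⊖ s) - M * M) → ∃ λ η → 0# ≺ η × FarOn (Near η s)
          from (h , 0≺h , h+h≈) = pack (continuous-sq {f = λ _ → step p i} {g = λ s → s}
              (λ k → continuous-const (step p i k)) continuous-coordinate h 0≺h)
            where
            pack : Eventually s (λ s′ → Within h (sq (step p i ⊖ s′) - sq (step p i ⊖ s))) → ∃ λ η → 0# ≺ η × FarOn (Near η s)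
            pack (η , 0≺η , q) = η , 0≺η , h , 0≺h , λ s′ s′∈ → i , 0≤⇒≤ (≤⇒0≤ (proj₁ (q s′∈)))
              (trans (solve 4 (λ x′ x m h → x′ :- x :- :- h := x′ :- m :- (x :- m) :+ h) refl
                  (sq (step p i ⊖ s′)) (sq (step p i ⊖ s)) (M * M) h)
                (trans (+-congʳ (+-congˡ (-‿cong (sym h+h≈))))
                  (solve 3 (λ x′ m h → x′ :- m :- (h :+ h) :+ h := x′ :- (m :+ h)) refl (sq (step p i ⊖ s′)) (M * M) h)))

        M+1≤⇒far : ∀ {x} → M + 1# ≤ x → M * M + 1# ≤ x * x
        M+1≤⇒far {x} q = ≤-trans
          (0≤⇒≤ (+-nonneg 0≤M 0≤M)
            (solve 1 (λ m → m :+ m := (m :+ con (+ 1)) :* (m :+ con (+ 1)) :- (m :* m :+ con (+ 1))) refl M))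
          (square-mono (+-nonneg 0≤M 0≤1) q)

        -- Outside the box, the first step alone differs from `s` by more than `M + 1` in some
        -- coordinate, and (M + 1)² ≥ M² + 1. The length `suc n` guarantees a first step.
        outside-far : ∀ {A} → Box A (step p zero) → ∀ s → ¬ Box (A + M + 1#) s → Far 1# s
        outside-far {A} bound s s∉ with em₀ (M * M + 1# ≤ sq (step p zero ⊖ s))
        ... | yes q = zero , q
        ... | no ¬q = ⊥-elim (s∉ λ k → above k , below k)
          where
          x : Point d
          x = step p zero
          close : ∀ k y → y * y ≈ (x ⊖ s) k * (x ⊖ s) k → y ≤ M + 1#
          close k y y²≈ = ≺⇒≤ λ q → ¬q (≤-trans (M+1≤⇒far q)
            (≤-trans (≤-reflexive y²≈) (coordinate≤sq (x ⊖ s) k)))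
          above : ∀ k → - (A + M + 1#) ≤ s k
          above k = 0≤⇒≤ (+-nonneg (≤⇒0≤ (close k (x k - s k) refl)) (≤⇒0≤ (proj₁ (bound k))))
            (solve 4 (λ a m x s → (m :+ con (+ 1) :- (x :- s)) :+ (x :- :- a) := s :- :- (a :+ m :+ con (+ 1))) refl
              A M (x k) (s k))
          below : ∀ k → s k ≤ A + M + 1#
          below k = 0≤⇒≤ (+-nonneg
              (≤⇒0≤ (close k (s k - x k) (solve 2 (λ x s → (s :- x) :* (s :- x) := (x :- s) :* (x :- s)) refl (x k) (s k))))
              (≤⇒0≤ (proj₂ (bound k))))
            (solve 4 (λ a m x s → (m :+ con (+ 1) :- (s :- x)) :+ (a :- x) := a :+ m :+ con (+ 1) :- s) refl
              A M (x k) (s k))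

        -- Compactness inside a large box and `outside-far` beyond it turn the pointwise excess over
        -- `M` into one common margin.
        everywhere-far : (∀ s → M ≺ spread p s) → FarOn (λ _ → ⊤)
        everywhere-far M≺ = bound (box-bound (step p zero))
          where
          bound : (∃ λ A → 0# ≤ A × Box A (step p zero)) → FarOn (λ _ → ⊤)
          bound (A , 0≤A , step∈) = glue (compact FarOn
              (λ { U⊆V (ε , 0≺ε , q) → ε , 0≺ε , λ s s∈ → q s (U⊆V s∈) })
              union (+-nonneg (+-nonneg 0≤A 0≤M) 0≤1)
              (λ s _ → far-near s (≻spread⇒far s (M≺ s))))
            where
            union : ∀ {U V} → FarOn U → FarOn V → FarOn (U ∪ V)
            union (ε , 0≺ε , q) (η , 0≺η , r) with ζ , 0≺ζ , ζ≤ε , ζ≤η ← pos-min 0≺ε 0≺η =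
              ζ , 0≺ζ , λ { s (inj₁ s∈) → far-weaken ζ≤ε (q s s∈) ; s (inj₂ s∈) → far-weaken ζ≤η (r s s∈) }
            decide : FarOn (λ s → Box (A + M + 1#) s ⊎ ¬ Box (A + M + 1#) s) → FarOn (λ _ → ⊤)
            decide (ε , 0≺ε , q) = ε , 0≺ε , λ s _ → q s (case s)
              where
              case : ∀ s → Box (A + M + 1#) s ⊎ ¬ Box (A + M + 1#) s
              case s with em₀ (Box (A + M + 1#) s)
              ... | yes s∈ = inj₁ s∈
              ... | no s∉ = inj₂ s∉
            glue : FarOn (Box (A + M + 1#)) → FarOn (λ _ → ⊤)
            glue inside = decide (union inside (1# , 0≺1 , outside-far step∈))

        -- A common margin would make `√ (M * M + ε)` a lower bound of the spreads, larger than
        -- their infimum.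
        not-everywhere-far : IsInf Spreads M → ¬ FarOn (λ _ → ⊤)
        not-everywhere-far (_ , greatest) (ε , 0≺ε , far) =
          x≺x+y 0≺ε (√≤⇒≤² 0≤M (greatest (√ (M * M + ε)) λ { r (s , r≈) → ≤-respʳ-≈ (sym r≈) (bound s (far s _)) }))
          where
          bound : ∀ s → Far ε s → √ (M * M + ε) ≤ spread p s
          bound s (i , q) = ≤-trans (√-mono q) (≤max (λ i → ‖ step p i ⊖ s ‖) i)

    abstract
      minimal-spread : ∃ (IsMin Spreads)
      minimal-spread = attained (infimum Spreads (spread p origin , origin , refl)
          (0# , λ { r (s , r≈) → ≤-respʳ-≈ (sym r≈) (max-nonneg (λ i → ‖ step p i ⊖ s ‖)) }))
        where
        attained : ∃ (IsInf Spreads) → ∃ (IsMin Spreads)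
        attained (M , isInf@(lower-bound , greatest)) with em₀ (∃ λ s → spread p s ≤ M)
        ... | yes (s , q) = M , (s , ≤-antisym (lower-bound _ (s , refl)) q) , lower-bound
        ... | no ¬q = ⊥-elim (not-everywhere-far 0≤M isInf (everywhere-far 0≤M (λ s q → ¬q (s , q))))
          where
          0≤M : 0# ≤ M
          0≤M = greatest 0# λ { r (s , r≈) → ≤-respʳ-≈ (sym r≈) (max-nonneg (λ i → ‖ step p i ⊖ s ‖)) }

  -- The constants as suprema of infima

  -- `complete` takes small predicates only; `True` of the decision given by `em` replaces a large
  -- predicate by an equivalent small one.
  supremum : (S : Pred Carrier (lsuc 0ℓ)) → Satisfiable S → ∃ (UpperBound S) → ∃ (IsSup S)
  supremum S (x , x∈S) (b , ub) = from (complete (λ y → True (em {S y}))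
      (x , fromWitness x∈S) (b , λ y y∈ → ub y (toWitness y∈)))
    where
    from : ∃ (IsSup (λ y → True (em {S y}))) → ∃ (IsSup S)
    from (s , ub′ , least) = s , (λ y y∈S → ub′ y (fromWitness y∈S)) ,
      λ b′ ub″ → least b′ (λ y y∈ → ub″ y (toWitness y∈))

  Values : {d m : ℕ} → (∀ {n} → Tuple d n → Carrier → Set) → Point d → (Fin m → Subset d) → Pred Carrier 0ℓ
  Values {d} {m} IsΔ t X r = Σ (Tuple d (suc m)) λ p → Admissible t X p × IsΔ p r

  Isδ : ∀ {n} → Tuple d n → Carrier → Set
  Isδ p v = v ≈ δ p

  small-δ′ : ∀ {d m} (t : Point d) (X : Fin m → Subset d) → (∀ i → OneDense (X i)) →
    Σ Carrier λ r → Values Isδ′ t X r × r ≤ 2# * √ 2#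
  small-δ′ t X dense = from (almost-equal-steps t X dense)
    where
    from : (Σ _ λ p → Σ _ λ s → Admissible t X p × (∀ i → ‖ step p i ⊖ s ‖ ≤ √ 2#)) →
      Σ Carrier λ r → Values Isδ′ t X r × r ≤ 2# * √ 2#
    from (p , s , admissible , close) = measure (minimal-spread p)
      where
      measure : ∃ (IsMin (Spreads p)) → Σ Carrier λ r → Values Isδ′ t X r × r ≤ 2# * √ 2#
      measure (M , isMin) = 2# * M , (p , admissible , M , isMin , refl) ,
        *-monoˡ-≤ (≺⇒≤ 0≺2) (≤-trans (proj₂ isMin _ (s , refl)) (max-lub (√-nonneg 2#) close))

  small-δ : ∀ {d m} (t : Point d) (X : Fin m → Subset d) → (∀ i → OneDense (X i)) →
    Σ Carrier λ r → Values Isδ t X r × r ≤ 2# * √ 2#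
  small-δ t X dense = from (small-δ′ t X dense)
    where
    from : (Σ Carrier λ r → Values Isδ′ t X r × r ≤ 2# * √ 2#) → Σ Carrier λ r → Values Isδ t X r × r ≤ 2# * √ 2#
    from (r , (p , admissible , is) , r≤) = δ p , (p , admissible , refl) , ≤-trans (δ≤δ′ p is) r≤

  module SupInf {d : ℕ} (IsΔ : ∀ {n} → Tuple d n → Carrier → Set)
    (nonneg : ∀ {n} (p : Tuple d n) {v} → IsΔ p v → 0# ≤ v)
    (small : ∀ {m} (t : Point d) (X : Fin m → Subset d) → (∀ i → OneDense (X i)) →
      Σ Carrier λ r → Values IsΔ t X r × r ≤ 2# * √ 2#) where

    value : ∀ {m} (t : Point d) (X : Fin m → Subset d) → (∀ i → OneDense (X i)) → ∃ (IsInf (Values IsΔ t X))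
    value t X dense = infimum (Values IsΔ t X)
      (proj₁ (small t X dense) , proj₁ (proj₂ (small t X dense)))
      (0# , λ { r (p , _ , is) → nonneg p is })

    sup-inf : Σ Carrier λ D → IsSupInf d IsΔ D × D ≤ 2# * √ 2#
    sup-inf = from (supremum _
        -- The set of values is inhabited by the case n = 1, t = 0, in which there are no sets to
        -- visit.
        (proj₁ trivial , 0 , origin , (λ ()) , (λ ()) , proj₂ trivial) (2# * √ 2# , bound))
      where
      trivial : ∃ (IsInf (Values IsΔ origin (λ ())))
      trivial = value origin (λ ()) (λ ())

      bound : UpperBound (λ v → Σ ℕ λ m → Σ (Point d) λ t → Σ (Fin m → Subset d) λ X →
        (∀ i → OneDense (X i)) × IsInf (Values IsΔ t X) v) (2# * √ 2#)
      bound v (m , t , X , dense , lb , _) =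
        ≤-trans (lb _ (proj₁ (proj₂ (small t X dense)))) (proj₂ (proj₂ (small t X dense)))

      from : ∃ (IsSupInf d IsΔ) → Σ Carrier λ D → IsSupInf d IsΔ D × D ≤ 2# * √ 2#
      from (D , isSup) = D , isSup , proj₂ isSup (2# * √ 2#) bound

  -- For fixed `t` and `X`, the infimum of δ bounds every value of δ′ from below by `δ≤δ′`. The
  -- infimum of δ′ has to be shown to exist before `D′`, a supremum of such infima, can be compared
  -- with it.
  D≤D′ : ∀ {d D D′} → IsD d D → IsD′ d D′ → D ≤ D′
  D≤D′ {d} {D} {D′} (_ , least) (ub′ , _) = least D′ bound
    where
    bound : UpperBound (λ v → Σ ℕ λ m → Σ (Point d) λ t → Σ (Fin m → Subset d) λ X →
      (∀ i → OneDense (X i)) × IsInf (Values Isδ t X) v) D′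
    bound v (m , t , X , dense , lb , _) = from (SupInf.value Isδ′ δ′-nonneg small-δ′ t X dense)
      where
      from : ∃ (IsInf (Values Isδ′ t X)) → v ≤ D′
      from (v′ , isInf′) = ≤-trans
        (proj₂ isInf′ v λ { r (p , admissible , is) → ≤-trans (lb (δ p) (p , admissible , refl)) (δ≤δ′ p is) })
        (ub′ v′ (m , t , X , dense , isInf′))

  δ-nonneg : (p : Tuple d n) {v : Carrier} → Isδ p v → 0# ≤ v
  δ-nonneg p v≈ = ≤-respʳ-≈ (sym v≈) (max-nonneg (λ j → max {toℕ j} λ i → ‖ step p (inject i) ⊖ step p j ‖))

  constants : ∀ d → Σ Carrier λ D → Σ Carrier λ D′ → IsD d D × IsD′ d D′ × D ≤ D′ × D′ ≤ 2# * √ 2#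
  constants d = from (SupInf.sup-inf Isδ δ-nonneg small-δ) (SupInf.sup-inf Isδ′ δ′-nonneg small-δ′)
    where
    from : (Σ Carrier λ D → IsD d D × D ≤ 2# * √ 2#) → (Σ Carrier λ D′ → IsD′ d D′ × D′ ≤ 2# * √ 2#) →
      Σ Carrier λ D → Σ Carrier λ D′ → IsD d D × IsD′ d D′ × D ≤ D′ × D′ ≤ 2# * √ 2#
    from (D , isD , _) (D′ , isD′ , D′≤) = D , D′ , isD , isD′ , D≤D′ isD isD′ , D′≤

theorem1 : ExcludedMiddle (lsuc 0ℓ) → (ℝ : CompleteOrderedField) →
    let open CompleteOrderedField ℝ
        open Euclidean ℝ
    in
    ((d m : ℕ) .{{_ : NonZero d}} (t : Point d) (X : Fin m → Subset d) → (∀ i → OneDense (X i)) →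
      Σ (Tuple d (suc m)) λ p → Σ (Point d) λ s →
        Admissible t X p × (∀ i → ‖ step p i ⊖ s ‖ ≤ √ 2#))
    ×
    ((d : ℕ) .{{_ : NonZero d}} →
      Σ Carrier λ D → Σ Carrier λ D′ →
        IsD d D × IsD′ d D′ × D ≤ D′ × D′ ≤ 2# * √ 2#)
theorem1 em ℝ = (λ d m t X dense → almost-equal-steps t X dense) , λ d → constants d
  where
  open Proof em ℝ
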